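{- Let $A\in\mathbb{Z}^{r\times n}$, $\mathbf{b}\in\mathbb{Z}^r$, $M=\begin{pmatrix}\mathrm{id}_n&\mathbf{0}\\ A&-\mathbf{b}\end{pmatrix}$, let $M_k\langle I;J\rangle$ be a (well-defined) matrix obtained from $M$ by $k$ successive pivot operations with row index set $I\subseteq[r]$ and column index set $J\subseteq[n]$, and let $i\in[r]\setminus I$. Let $\mathfrak{c}^+_i,\mathfrak{c}^-_i$ be computed for $[M_k\langle I;J\rangle]$ as in the context. If $\mathfrak{c}^+_i<\infty$, then $$\mathop{\mathrm{CT}}_{\lambda_i}[M_k\langle I;J\rangle]=\sum_{j:\ \gamma_j\text{ is contributing}}\mathrm{sgn}(p_{k+1})\,\mathcal{Z}_{y_j}\big[M_k\langle I;J\rangle\leftarrow(i,j)\big].$$ If $\mathfrak{c}^-_i<\infty$, then $$\mathop{\mathrm{CT}}_{\lambda_i}[M_k\langle I;J\rangle]=-\sum_{j:\ \gamma_j\text{ is dually contributing}}\mathrm{sgn}(p_{k+1})\,\mathcal{Z}_{y_j}\big[M_k\langle I;J\rangle\leftarrow(i,j)\big].$$ Here $p_{k+1}$ (depending on $j$) is the $(n+i,j)$ entry of $M_k\langle I;J\rangle$.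
   Context: Variables: $\mathbf{y}=(y_1,\dots,y_n)$, $\Lambda=(\lambda_1,\dots,\lambda_r)$. "Fractional" means that rational exponents are allowed. All rational functions are expanded in the field of iterated Laurent series $G=\mathbb{C}((\lambda_r^{1/N}))\cdots((\lambda_1^{1/N}))((y_n^{1/N}))\cdots((y_1^{1/N}))$, where $N$ is a sufficiently divisible positive integer. A monomial $x=\zeta(\mathbf{y},\Lambda)^\alpha$ ($\zeta\in\mathbb{C}^*$, $\alpha\in\mathbb{Q}^{n+r}$ nonzero) is small if the first nonzero entry of $\alpha$ is positive, large otherwise; in $G$, $\frac1{1-x}=\sum_{t\ge0}x^t$ if $x$ is small and $\frac1{1-x}=-\sum_{t\ge0}x^{ -t-1}$ if $x$ is large. $\mathrm{CT}_{\lambda_i}$ extracts the part of exponent $0$ in $\lambda_i$ of the expansion in $G$. Matrix forms. For an $(n+r)\times(n+1)$ matrix $O$ with nonzero $(n+i,j)$ entry ($i\in[r]$, $j\in[n]$), $O\leftarrow(i,j)$ is obtained from $O$ by adding $-O_{n+i,s}/O_{n+i,j}$ times column $j$ to column $s$ for all $s\ne j$; row $n+i$ and column $j$ are ignored afterwards. For $I=\{i_1,\dots,i_k\}$, $J=\{j_1,\dots,j_k\}$, $M_k\langle I;J\rangle=M\leftarrow(i_1,j_1)\leftarrow\cdots\leftarrow(i_k,j_k)$ (all pivots nonzero), with rows $n+I$ and columns $J$ ignored. With columns $\gamma_1,\dots,\gamma_{n+1}$ (entries in ignored rows omitted), $[M_k\langle I;J\rangle]=(\mathbf{y},\Lambda)^{\gamma_{n+1}}\big/\prod_{j\in[n]\setminus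 J}\big(1-(\mathbf{y},\Lambda)^{\gamma_j}\big)$. $\mathcal{Z}_{y_j}$ keeps exactly the terms of a fractional series in which the exponent of $y_j$ is an integer. Contributing columns. A nonzero vector is small if its first nonzero entry is positive and large otherwise. For $j\in[n]\setminus J$, let $b_j$ be the entry of $\gamma_j$ in row $n+i$, and let $b_0$ be the entry of $\gamma_{n+1}$ in row $n+i$. $\gamma_j$ is contributing (with respect to $\lambda_i$) if $b_j\ne0$ and $b_j\gamma_j$ is small; it is dually contributing if $b_j\neq0$ and $b_j\gamma_j$ is large. Set $\deg=b_0-\sum_{j\notin J,\,b_j>0}b_j$ (the degree of $[M_k\langle I;J\rangle]$ in $\lambda_i$) and $\mathrm{ord}=-b_0+\sum_{j\notin J,\,b_j<0}b_j$ (its pole order at $\lambda_i=0$). $\mathfrak{c}^+_i$ is the number of contributing columns if $\deg<0$, and $\infty$ if $\deg\ge0$; $\mathfrak{c}^-_i$ is the number of dually contributing columns if $\mathrm{ord}<0$, and $\infty$ if $\mathrm{ord}\ge0$. -}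

module Defs where

open import Algebra.Bundles.Raw using (RawMonoid; RawRing)
import Algebra.Definitions.RawMonoid as RawMonoidDefs
open import Data.Fin.Base using (Fin; zero; suc; toℕ; splitAt; _↑ˡ_; _↑ʳ_)
import Data.Fin.Base as Fin
import Data.Fin.Properties as Fin
open import Data.Fin.Subset using (Subset; _∈_; _∉_; _∪_; ⁅_⁆; ⊥)
open import Data.Fin.Subset.Properties using (_∈?_)
open import Data.Integer.Base using (ℤ; +_; +0; +[1+_]; -[1+_])
import Data.Integer.Base as ℤ
import Data.Integer.Divisibility.Signed as ℤ
import Data.Integer.Properties as ℤ
open import Data.List.Base using (allFin; filter; length)
open import Data.Nat.Base using (ℕ; zero; suc)
import Data.Nat.Base as ℕ
import Data.Nat.Divisibility as ℕ
open import Data.Product.Base using (∃-syntax; _×_; _,_; proj₁; proj₂)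
open import Data.Rational.Base using (ℚ; 0ℚ; 1ℚ; ↥_; ↧ₙ_; NonZero; ≢-nonZero; _÷_)
import Data.Rational.Base as ℚ
import Data.Rational.Properties as ℚ
open import Data.Sum.Base using (inj₁; inj₂)
open import Data.Vec.Functional using (Vector; tail)
open import Level using (Level)
open import Relation.Binary.Definitions using (tri<; tri≈; tri>)
open import Relation.Binary.PropositionalEquality.Core using (_≡_; _≢_)
open import Relation.Nullary.Construct.Add.Supremum using (_⁺; [_]; ⊤⁺)
open import Relation.Nullary.Decidable.Core
  using (Dec; yes; no; ¬?; _×-dec_; _→-dec_)
open import Relation.Unary using (Pred; Decidable)

private
  variable
    a c ℓ p : Level
    m n r : ℕ

branch : {A : Set a} {P : Set p} → Dec P → (P → A) → A → A
branch (yes q) f x = f q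
branch (no _)  f x = x

-- The combination, in the monoid, of the f j with P j.
foldOver : (M : RawMonoid c ℓ) {P : Pred (Fin n) p} →
           Decidable P → (∀ j → P j → RawMonoid.Carrier M) → RawMonoid.Carrier M
foldOver M P? f = RawMonoidDefs.sum M (λ j → branch (P? j) (f j) (RawMonoid.ε M))

-- ⟨ d , f ⟩ stands for Σ_{k ≥ 0} f k · x^{d + k}; the leading coefficient
-- f 0 may vanish, so a series has many such representations.
record Laurent (A : Set a) : Set a where
  constructor ⟨_,_⟩
  field
    start  : ℤ
    coeffs : ℕ → A

open Laurent public

module _ (R : RawRing c ℓ) where
  open RawRing R

  coefficient : Laurent Carrier → ℤ → Carrier
  coefficient ⟨ d , f ⟩ e = branch (d ℤ.≤? e) (λ _ → f ℤ.∣ e ℤ.- d ∣) 0#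

  term : Carrier → ℤ → Laurent Carrier
  term x e = ⟨ e , (λ { zero → x ; (suc _) → 0# }) ⟩

  laurentRing : RawRing c ℓ
  laurentRing = record
    { Carrier = Laurent Carrier
    ; _≈_     = λ f g → ∀ e → coefficient f e ≈ coefficient g e
    ; _+_     = λ f g → let d = start f ℤ.⊓ start g in
                  ⟨ d , (λ k → coefficient f (d ℤ.+ + k) + coefficient g (d ℤ.+ + k)) ⟩
    ; _*_     = λ f g →
                  ⟨ start f ℤ.+ start g
                  , (λ k → RawMonoidDefs.sum +-rawMonoid {suc k}
                      (λ l → coeffs f (toℕ l) * coeffs g (k ℕ.∸ toℕ l))) ⟩
    ; -_      = λ f → ⟨ start f , (λ k → - coeffs f k) ⟩
    ; 0#      = term 0# +0
    ; 1#      = term 1# +0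
    }

-- K((x_{m-1}))⋯((x_1))((x_0)): the variable with index zero is outermost.
iteratedLaurent : RawRing c ℓ → ℕ → RawRing c ℓ
iteratedLaurent K zero    = K
iteratedLaurent K (suc m) = laurentRing (iteratedLaurent K m)

Small Large : Vector ℚ m → Set
Small α = ∃[ p ] (∀ q → q Fin.< p → α q ≡ 0ℚ) × 0ℚ ℚ.< α p
Large α = ∃[ p ] (∀ q → q Fin.< p → α q ≡ 0ℚ) × α p ℚ.< 0ℚ

private
  zeroBefore? : (α : Vector ℚ m) (p : Fin m) → Dec (∀ q → q Fin.< p → α q ≡ 0ℚ)
  zeroBefore? α p = Fin.all? (λ q → (q Fin.<? p) →-dec (α q ℚ.≟ 0ℚ))

small? : (α : Vector ℚ m) → Dec (Small α)
small? α = Fin.any? (λ p → zeroBefore? α p ×-dec (0ℚ ℚ.<? α p))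

large? : (α : Vector ℚ m) → Dec (Large α)
large? α = Fin.any? (λ p → zeroBefore? α p ×-dec (α p ℚ.<? 0ℚ))

-- The fractional series with exponents in (1/N)ℤ are elements of the ring
-- G m below; the index z : ℤ of a coefficient stands for the exponent z / N.

-- N · q, provided the denominator of q divides N (the only case that is used).
scale : ℕ → ℚ → ℤ
scale N q = ↥ q ℤ.* + (N ℕ./ ↧ₙ q)

module Series (K : RawRing c ℓ) (N : ℕ) where

  G : ℕ → RawRing c ℓ
  G = iteratedLaurent K

  module 𝔾 (m : ℕ) = RawRing (G m)

  ∣G_∣ : ℕ → Set c
  ∣G m ∣ = 𝔾.Carrier m

  monomialℤ : Vector ℤ m → ∣G m ∣
  monomialℤ {zero}  α = 𝔾.1# 0
  monomialℤ {suc m} α = term (G m) (monomialℤ (tail α)) (α zero)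

  -- Σ_{t ≥ 0} x^t for x the monomial with exponent vector α, where the first
  -- nonzero entry of α is positive (the value is irrelevant otherwise).  If
  -- α zero = a > 0, the coefficient of the outermost variable to the power k
  -- is that of x^{k / a} when a divides k, and is 0 when it does not.
  geometricℤ : Vector ℤ m → ∣G m ∣
  geometricℤ {zero}  α = 𝔾.0# 0
  geometricℤ {suc m} α with α zero
  ... | +0       = term (G m) (geometricℤ (tail α)) +0
  ... | +[1+ a ] = ⟨ +0 , (λ k → branch (suc a ℕ.∣? k)
                     (λ _ → monomialℤ (λ p → + (k ℕ./ suc a) ℤ.* tail α p)) (𝔾.0# m)) ⟩
  ... | -[1+ _ ] = 𝔾.0# (suc m)

  monomial : Vector ℚ m → ∣G m ∣
  monomial α = monomialℤ (λ p → scale N (α p))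

  geometric : Vector ℚ m → ∣G m ∣
  geometric α = geometricℤ (λ p → scale N (α p))

  -- The expansion of 1 / (1 - x) for x the monomial with exponent vector α:
  -- Σ x^t if α is small and - Σ x^{-t-1} = - x^{-1} Σ (x^{-1})^t if α is large.
  -- The zero vector, for which 1 - x is not invertible, is sent to 0.
  1/[1-x^_] : Vector ℚ m → ∣G m ∣
  1/[1-x^_] {m} α =
    branch (small? α) (λ _ → geometric α)
      (branch (large? α) (λ _ → - (monomial -α * geometric -α)) 0#)
    where
    open RawRing (G m) using (-_; _*_; 0#)
    -α : Vector ℚ _
    -α p = ℚ.- α p

  CT : Fin m → ∣G m ∣ → ∣G m ∣
  CT {suc m} zero    f = term (G m) (coefficient (G m) f +0) +0
  CT {suc m} (suc p) f = ⟨ start f , (λ k → CT p (coeffs f k)) ⟩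

  -- Keeps the terms in which the exponent of variable p is an integer.
  𝒵 : Fin m → ∣G m ∣ → ∣G m ∣
  𝒵 {suc m} zero    f = ⟨ start f , (λ k →
    branch (+ N ℤ.∣? (start f ℤ.+ + k)) (λ _ → coeffs f k) (𝔾.0# m)) ⟩
  𝒵 {suc m} (suc p) f = ⟨ start f , (λ k → 𝒵 p (coeffs f k)) ⟩

  sgn : ∀ m → ℚ → ∣G m ∣
  sgn m q with ℚ.<-cmp q 0ℚ
  ... | tri< _ _ _ = 𝔾.-_ m (𝔾.1# m)
  ... | tri≈ _ _ _ = 𝔾.0# m
  ... | tri> _ _ _ = 𝔾.1# m

Matrix : ℕ → ℕ → Set
Matrix n r = Fin (n ℕ.+ r) → Fin (n ℕ.+ 1) → ℚ

yRow : Fin n → Fin (n ℕ.+ r)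
yRow {r = r} j = j ↑ˡ r

λRow : Fin r → Fin (n ℕ.+ r)
λRow {n = n} i = n ↑ʳ i

col : Fin n → Fin (n ℕ.+ 1)
col j = j ↑ˡ 1

lastCol : Fin (n ℕ.+ 1)
lastCol {n = n} = n ↑ʳ zero

-- The block matrix with block rows (id_n , 0) and (A , -b).
initial : (Fin r → Fin n → ℤ) → (Fin r → ℤ) → Matrix n r
initial {r} {n} A b p s with splitAt n p | splitAt n s
... | inj₁ l | inj₁ j = branch (l Fin.≟ j) (λ _ → 1ℚ) 0ℚ
... | inj₁ l | inj₂ _ = 0ℚ
... | inj₂ i | inj₁ j = A i j ℚ./ 1
... | inj₂ i | inj₂ _ = ℤ.- b i ℚ./ 1

pivot : (O : Matrix n r) (i : Fin r) (j : Fin n) → .{{NonZero (O (λRow i) (col j))}} →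
        Matrix n r
pivot O i j p s = branch (s Fin.≟ col j) (λ _ → O p s)
  (O p s ℚ.- (O (λRow i) s ÷ O (λRow i) (col j)) ℚ.* O p (col j))

-- Pivots M k I J O: O is a matrix M_k⟨I;J⟩, obtained from M by k successive
-- pivots on nonzero entries, with row index set I and column index set J.
data Pivots {n r} (M : Matrix n r) : ℕ → Subset r → Subset n → Matrix n r → Set where
  none : Pivots M 0 ⊥ ⊥ M
  step : ∀ {k I J O} → Pivots M k I J O →
         ∀ i j → i ∉ I → j ∉ J → .{{_ : NonZero (O (λRow i) (col j))}} →
         Pivots M (suc k) (I ∪ ⁅ i ⁆) (J ∪ ⁅ j ⁆) (pivot O i j)

-- Column s as an exponent vector.  The variables λ_i with i ∈ I do not occur
-- in the monomial: omitting their rows means giving them exponent 0.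
exponents : Matrix n r → Subset r → Fin (n ℕ.+ 1) → Vector ℚ (n ℕ.+ r)
exponents {n} O I s p with splitAt n p
... | inj₁ _ = O p s
... | inj₂ i = branch (i ∈? I) (λ _ → 0ℚ) (O p s)

DenominatorsDivide : ℕ → Matrix n r → Set
DenominatorsDivide N O = ∀ p s → ↧ₙ (O p s) ℕ.∣ N

module _ {n r} (O : Matrix n r) (I : Subset r) (J : Subset n) (i : Fin r) where

  private
    b₀ : ℚ
    b₀ = O (λRow i) lastCol

    b : Fin n → ℚ
    b j = O (λRow i) (col j)

    b·γ : Fin n → Vector ℚ (n ℕ.+ r)
    b·γ j p = b j ℚ.* exponents O I (col j) p

  Contributing DuallyContributing : Fin n → Set
  Contributing       j = j ∉ J × b j ≢ 0ℚ × Small (b·γ j)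
  DuallyContributing j = j ∉ J × b j ≢ 0ℚ × Large (b·γ j)

  contributing? : Decidable Contributing
  contributing? j = ¬? (j ∈? J) ×-dec (¬? (b j ℚ.≟ 0ℚ) ×-dec small? (b·γ j))

  duallyContributing? : Decidable DuallyContributing
  duallyContributing? j = ¬? (j ∈? J) ×-dec (¬? (b j ℚ.≟ 0ℚ) ×-dec large? (b·γ j))

  degree order : ℚ
  degree = b₀ ℚ.- foldOver ℚ.+-0-rawMonoid
                    (λ j → ¬? (j ∈? J) ×-dec (0ℚ ℚ.<? b j)) (λ j _ → b j)
  order  = ℚ.- b₀ ℚ.+ foldOver ℚ.+-0-rawMonoid
                    (λ j → ¬? (j ∈? J) ×-dec (b j ℚ.<? 0ℚ)) (λ j _ → b j)

  𝔠⁺ 𝔠⁻ : ℕ ⁺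
  𝔠⁺ = branch (degree ℚ.<? 0ℚ) (λ _ → [ length (filter contributing? (allFin n)) ]) ⊤⁺
  𝔠⁻ = branch (order ℚ.<? 0ℚ) (λ _ → [ length (filter duallyContributing? (allFin n)) ]) ⊤⁺

module Brackets (K : RawRing c ℓ) (N : ℕ) {n r : ℕ} where
  open Series K N public
  open RawRing (G (n ℕ.+ r)) public
    using (Carrier; _≈_; _+_; _*_; -_; +-rawMonoid; *-rawMonoid)

  bracket : Matrix n r → Subset r → Subset n → Carrier
  bracket O I J =
    monomial (exponents O I lastCol) *
    foldOver *-rawMonoid (λ j → ¬? (j ∈? J)) (λ j _ → 1/[1-x^ exponents O I (col j) ])

  -- sgn(p) 𝒵_{y_j} [O ← (i , j)], where p is the pivot entry.
  pivotTerm : (O : Matrix n r) → Subset r → Subset n → (i : Fin r) (j : Fin n) →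
              O (λRow i) (col j) ≢ 0ℚ → Carrier
  pivotTerm O I J i j p≢0 =
    sgn (n ℕ.+ r) (O (λRow i) (col j)) *
    𝒵 (yRow j) (bracket (pivot O i j {{≢-nonZero p≢0}}) (I ∪ ⁅ i ⁆) (J ∪ ⁅ j ⁆))

  contributingSum duallyContributingSum : Matrix n r → Subset r → Subset n → Fin r → Carrier
  contributingSum O I J i =
    foldOver +-rawMonoid (contributing? O I J i)
      (λ j con → pivotTerm O I J i j (proj₁ (proj₂ con)))
  duallyContributingSum O I J i =
    foldOver +-rawMonoid (duallyContributing? O I J i)
      (λ j con → pivotTerm O I J i j (proj₁ (proj₂ con)))

{-# OPTIONS --safe #-}

-- A term of [M⟨I;J⟩] is the choice of an integer t_s for every s ∉ J; it has exponent vector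
-- γ_{n+1} + Σ t_s γ_s, and t_s can be read off as its exponent of y_s.  Its coefficient is the product
-- of the e_s(t_s), where e_s(t) = [t ≥ 0] if γ_s is small and e_s(t) = -[t < 0] if γ_s is large.  If
-- the exponent of λ_i vanishes, then the same exponent vector occurs in [M⟨I;J⟩ ← (i,j)], with the
-- same t_s for s ≠ j, and 𝒵_{y_j} restores the condition that t_j be an integer.  So the claim is an
-- identity of coefficients for every single t with b_0 + Σ t_s b_s = 0.
--
-- For b_s ≠ 0 put v_s = γ_s / b_s, ordered lexicographically.  Since γ_s - (b_s / b_j) γ_j is
-- b_s (v_s - v_j), both sides are built from the products F(u) of the coefficients obtained by calling
-- column s small when b_s (v_s - u) is: the left-hand side is F(0), and moving u past v_j changes F by
-- sgn(b_j) times the coefficient of the term of j.  The sum over v_j > 0 telescopes to F(0) - F(∞) and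
-- that over v_j < 0 to F(-∞) - F(0), and F(±∞) = 0 by the degree or order condition.

module Submission where

open import Defs
open import Algebra.Bundles using (CommutativeRing; CommutativeSemiring)
open import Algebra.Bundles.Raw using (RawRing)
import Algebra.Definitions.RawMonoid as RawMonoidSum
import Algebra.Properties.Ring as RingProperties
open import Data.Bool.Base using (Bool; true; false; not; _∧_; if_then_else_)
open import Data.Bool.Properties using (∧-identityʳ)
open import Data.Fin.Base as Fin using (Fin; zero; suc; toℕ; fromℕ<; splitAt)
import Data.Fin.Properties as Fin
open import Data.Fin.Subset using (Subset; _∈_; _∉_; _∪_; ⁅_⁆)
open import Data.Fin.Subset.Properties
  using (_∈?_; p⊆p∪q; q⊆p∪q; x∈⁅x⁆; x∈⁅y⁆⇒x≡y; x∈p∪q⁻)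
open import Data.Integer.Base as ℤ using (ℤ; +_; +0; +[1+_]; -[1+_])
import Data.Integer.Divisibility.Signed as ℤ
import Data.Integer.Properties as ℤ
open import Data.Integer.Tactic.RingSolver using (solve-∀)
open import Data.Nat.Base as ℕ using (ℕ; zero; suc)
import Data.Nat.Divisibility as ℕ
import Data.Nat.DivMod as ℕ
import Data.Nat.Properties as ℕ
open import Data.Product.Base using (∃-syntax; _×_; _,_; proj₁; proj₂)
open import Data.Rational.Base as ℚ using (ℚ; 0ℚ; 1ℚ; ↥_; ↧ₙ_; mkℚ; NonZero; ≢-nonZero)
open import Data.Rational.Literals using (fromℤ)
import Data.Rational.Properties as ℚ
open import Data.Rational.Solver using (module +-*-Solver)
open import Data.Rational.Unnormalised.Base using (*≡*)
import Data.Rational.Unnormalised.Properties as ℚᵘ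
open import Data.Sum.Base as Sum using (_⊎_; inj₁; inj₂; [_,_]′)
open import Data.Unit.Base using (⊤; tt)
open import Data.Vec.Functional using (Vector; tail; _∷_; updateAt)
open import Data.Vec.Functional.Properties using (updateAt-updates; updateAt-minimal)
open import Function.Base using (_∘_; id; const)
open import Level using (Level)
open import Relation.Binary.Construct.Add.Supremum.Strict ℕ._<_ using (_<⁺_)
open import Relation.Binary.Definitions using (tri<; tri≈; tri>)
open import Relation.Binary.PropositionalEquality as ≡ using (_≡_; _≢_; _≗_)
open import Relation.Nullary.Construct.Add.Supremum using (⊤⁺)
open import Relation.Nullary.Decidable
  using (Dec; yes; no; does; ¬?; _×-dec_; dec-true; dec-false)
import Relation.Nullary.Decidable as Dec
open import Relation.Nullary.Negation using (¬_; contradiction)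
open import Relation.Unary using (Pred; Decidable)

-- The tower of Laurent series comes with raw operations only, so no ring law of it is used: series
-- are compared coefficient by coefficient and all algebra takes place in `K`. The same rows keep
-- the vectors v_s of different columns apart, so the order has no ties. Passing v_j changes F by
-- sgn(b_j) times the product of the other factors because the two expansions of 1/(1-x) differ by
-- the sum of x^t over all integers t: the value of t_j drops out, as it must for a term in which
-- column j has been eliminated. The telescoping runs by induction on the number of columns, with no
-- sorting: the first column cuts the range into the part below it and the part above it.

module ℤ-Ring = RingProperties ℤ.+-*-ring

private
  variable
    a p q : Level
    m n r : ℕ

-- Coefficients of iterated Laurent series

branch-elim : {A : Set a} {P : Set p} (Q : A → Set q) (d : Dec P) {f : P → A} {x : A} →
              (∀ h → Q (f h)) → (¬ P → Q x) → Q (branch d f x)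
branch-elim Q (yes h) y n = y h
branch-elim Q (no ¬h) y n = n ¬h

-- The case split behind every coefficient computation: an exponent is either at a stored position
-- of a series with start `d`, or below the start, where the coefficient is zero.
offset : ∀ d e → (∃[ k ] e ≡ d ℤ.+ + k) ⊎ e ℤ.< d
offset d e with d ℤ.≤? e
... | no d≰e  = inj₂ (ℤ.≰⇒> d≰e)
... | yes d≤e = inj₁ (ℤ.∣ e ℤ.- d ∣ ,
  ≡.sym (≡.trans (≡.cong (ℤ._+_ d) (ℤ.0≤i⇒+∣i∣≡i (ℤ.i≤j⇒0≤j-i d≤e))) (regroup d e)))
  where
  regroup : ∀ d e → d ℤ.+ (e ℤ.- d) ≡ e
  regroup = solve-∀

module _ {c ℓ} (R : RawRing c ℓ) where
  open RawRing R

  coefficient-at : ∀ f k → coefficient R f (start f ℤ.+ + k) ≡ coeffs f k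
  coefficient-at f k = branch-elim (_≡ coeffs f k) (start f ℤ.≤? start f ℤ.+ + k)
    (λ _ → ≡.cong (coeffs f) (≡.cong ℤ.∣_∣ (regroup (start f) (+ k))))
    (contradiction (ℤ.i≤i+j (start f) (+ k)))
    where
    regroup : ∀ d k → d ℤ.+ k ℤ.- d ≡ k
    regroup = solve-∀

  coefficient-below : ∀ f {e} → e ℤ.< start f → coefficient R f e ≡ 0#
  coefficient-below f {e} e<d = branch-elim (_≡ 0#) (start f ℤ.≤? e)
    (λ d≤e → contradiction d≤e (ℤ.<⇒≱ e<d)) (λ _ → ≡.refl)

  coefficient-term : ∀ x e → coefficient R (term R x e) e ≡ x
  coefficient-term x e = ≡.trans (≡.cong (coefficient R (term R x e)) (≡.sym (ℤ.+-identityʳ e)))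
                                 (coefficient-at (term R x e) 0)

  coefficient-term-≢ : ∀ x d e → e ≢ d → coefficient R (term R x d) e ≡ 0#
  coefficient-term-≢ x d e e≢d with offset d e
  ... | inj₂ e<d               = coefficient-below (term R x d) e<d
  ... | inj₁ (zero , ≡.refl)   = contradiction (ℤ.+-identityʳ d) e≢d
  ... | inj₁ (suc k , ≡.refl)  = coefficient-at (term R x d) (suc k)

infixl 6 _⊖_

_⊖_ : Vector ℤ m → Vector ℤ m → Vector ℤ m
(u ⊖ v) p = u p ℤ.- v p

module Coefficients {c ℓ} (K : CommutativeRing c ℓ) where
  open CommutativeRing K hiding (zero)
  open import Algebra.Properties.Ring ring using (-0#≈0#)
  open import Algebra.Properties.Semiring.Sum semiring
    using (sum; sum-cong-≋; sum-replicate-zero)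
  open import Relation.Binary.Reasoning.Setoid setoid hiding (start)

  private
    G : ℕ → RawRing c ℓ
    G = iteratedLaurent rawRing
    module 𝔾 (m : ℕ) = RawRing (G m)

  coef : ∀ m → 𝔾.Carrier m → Vector ℤ m → Carrier
  coef zero    f e = f
  coef (suc m) f e = coef m (coefficient (G m) f (e zero)) (tail e)

  coef-ext : ∀ m {f g} → (∀ e → coef m f e ≈ coef m g e) → 𝔾._≈_ m f g
  coef-ext zero    f≈g = f≈g (λ ())
  coef-ext (suc m) f≈g e = coef-ext m (λ e′ → f≈g (e ∷ e′))

  coef-≡ : ∀ m {f g} → f ≡ g → ∀ e → coef m f e ≈ coef m g e
  coef-≡ m f≡g e = reflexive (≡.cong (λ h → coef m h e) f≡g)

  coef-0# : ∀ m e → coef m (𝔾.0# m) e ≈ 0#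
  coef-0# zero    e = refl
  coef-0# (suc m) e with e zero ℤ.≟ +0
  ... | yes e₀≡0 rewrite e₀≡0 =
    trans (coef-≡ m (coefficient-term (G m) (𝔾.0# m) +0) (tail e)) (coef-0# m (tail e))
  ... | no  e₀≢0 =
    trans (coef-≡ m (coefficient-term-≢ (G m) (𝔾.0# m) +0 (e zero) e₀≢0) (tail e)) (coef-0# m (tail e))

  module _ (m : ℕ) (f : 𝔾.Carrier (suc m)) (e : Vector ℤ (suc m)) where

    coef-at : ∀ k → e zero ≡ start f ℤ.+ + k → coef (suc m) f e ≈ coef m (coeffs f k) (tail e)
    coef-at k eq rewrite eq = coef-≡ m (coefficient-at (G m) f k) (tail e)

    coef-below : e zero ℤ.< start f → coef (suc m) f e ≈ 0#
    coef-below e₀<d = trans (coef-≡ m (coefficient-below (G m) f e₀<d) (tail e)) (coef-0# m (tail e))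

  coef-term : ∀ m x d e → e zero ≡ d → coef (suc m) (term (G m) x d) e ≈ coef m x (tail e)
  coef-term m x d e ≡.refl = coef-≡ m (coefficient-term (G m) x d) (tail e)

  coef-term-≢ : ∀ m x d e → e zero ≢ d → coef (suc m) (term (G m) x d) e ≈ 0#
  coef-term-≢ m x d e e₀≢d =
    trans (coef-≡ m (coefficient-term-≢ (G m) x d (e zero) e₀≢d) (tail e)) (coef-0# m (tail e))

  coef-+ : ∀ m f g e → coef m (𝔾._+_ m f g) e ≈ coef m f e + coef m g e
  coef-+ zero    f g e = refl
  coef-+ (suc m) f g e with offset (start f ℤ.⊓ start g) (e zero)
  ... | inj₁ (k , eq) = begin
    coef (suc m) (𝔾._+_ (suc m) f g) e
      ≈⟨ coef-at m (𝔾._+_ (suc m) f g) e k eq ⟩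
    coef m (𝔾._+_ m (coefficient (G m) f d) (coefficient (G m) g d)) (tail e)
      ≈⟨ coef-+ m _ _ (tail e) ⟩
    coef m (coefficient (G m) f d) (tail e) + coef m (coefficient (G m) g d) (tail e)
      ≡⟨ ≡.cong (λ z → coef m (coefficient (G m) f z) (tail e) + coef m (coefficient (G m) g z) (tail e)) eq ⟨
    coef (suc m) f e + coef (suc m) g e ∎
    where d = start f ℤ.⊓ start g ℤ.+ + k
  ... | inj₂ e₀<d = begin
    coef (suc m) (𝔾._+_ (suc m) f g) e   ≈⟨ coef-below m (𝔾._+_ (suc m) f g) e e₀<d ⟩
    0#                                   ≈⟨ +-identityˡ 0# ⟨
    0# + 0#                              ≈⟨ +-cong (coef-below m f e (ℤ.<-≤-trans e₀<d (ℤ.i⊓j≤i _ _)))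
                                                   (coef-below m g e (ℤ.<-≤-trans e₀<d (ℤ.i⊓j≤j _ _))) ⟨
    coef (suc m) f e + coef (suc m) g e  ∎

  coef-neg : ∀ m f e → coef m (𝔾.-_ m f) e ≈ - coef m f e
  coef-neg zero    f e = refl
  coef-neg (suc m) f e with offset (start f) (e zero)
  ... | inj₁ (k , eq) = begin
    coef (suc m) (𝔾.-_ (suc m) f) e        ≈⟨ coef-at m (𝔾.-_ (suc m) f) e k eq ⟩
    coef m (𝔾.-_ m (coeffs f k)) (tail e)  ≈⟨ coef-neg m _ (tail e) ⟩
    - coef m (coeffs f k) (tail e)         ≈⟨ -‿cong (coef-at m f e k eq) ⟨
    - coef (suc m) f e                     ∎
  ... | inj₂ e₀<d = begin
    coef (suc m) (𝔾.-_ (suc m) f) e  ≈⟨ coef-below m (𝔾.-_ (suc m) f) e e₀<d ⟩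
    0#                               ≈⟨ -0#≈0# ⟨
    - 0#                             ≈⟨ -‿cong (coef-below m f e e₀<d) ⟨
    - coef (suc m) f e               ∎

  coef-sum : ∀ m {n} (F : Vector (𝔾.Carrier m) n) e →
             coef m (RawMonoidSum.sum (𝔾.+-rawMonoid m) F) e ≈ sum (λ j → coef m (F j) e)
  coef-sum m {zero}  F e = coef-0# m e
  coef-sum m {suc n} F e = trans (coef-+ m _ _ e) (+-congˡ (coef-sum m (tail F) e))

  sum-zero : ∀ {n} (F : Vector Carrier n) → (∀ l → F l ≈ 0#) → sum F ≈ 0#
  sum-zero {n} F F≈0 = trans (sum-cong-≋ F≈0) (sum-replicate-zero n)

  sum-single : ∀ {n} (F : Vector Carrier n) l₀ → (∀ l → l ≢ l₀ → F l ≈ 0#) → sum F ≈ F l₀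
  sum-single F zero     off =
    trans (+-congˡ (sum-zero (tail F) (λ l → off (suc l) λ ()))) (+-identityʳ _)
  sum-single F (suc l₀) off =
    trans (+-cong (off zero λ ()) (sum-single (tail F) l₀ (λ l l≢ → off (suc l) (l≢ ∘ Fin.suc-injective))))
          (+-identityˡ _)

  -- A product of series is only ever needed where at most one pair of terms contributes.
  coef-* : ∀ m f g e a →
           (∀ x → ¬ x ≗ a → coef m f (e ⊖ x) * coef m g x ≈ 0#) →
           coef m (𝔾._*_ m f g) e ≈ coef m f (e ⊖ a) * coef m g a
  coef-* zero    f g e a off = refl
  coef-* (suc m) f g e a off with offset (start f ℤ.+ start g) (e zero)
  ... | inj₂ e₀<d = trans (coef-below m (𝔾._*_ (suc m) f g) e e₀<d) (sym rhs≈0)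
    where
    regroup : ∀ e a → e ≡ (e ℤ.- a) ℤ.+ a
    regroup = solve-∀
    rhs≈0 : coef (suc m) f (e ⊖ a) * coef (suc m) g a ≈ 0#
    rhs≈0 with e zero ℤ.- a zero ℤ.<? start f | a zero ℤ.<? start g
    ... | yes e-a<d | _       = trans (*-congʳ (coef-below m f (e ⊖ a) e-a<d)) (zeroˡ _)
    ... | no _      | yes a<d = trans (*-congˡ (coef-below m g a a<d)) (zeroʳ _)
    ... | no e-a≮d  | no a≮d  = contradiction e₀<d (ℤ.≤⇒≯
      (≡.subst (_ ℤ.≤_) (≡.sym (regroup (e zero) (a zero))) (ℤ.+-mono-≤ (ℤ.≮⇒≥ e-a≮d) (ℤ.≮⇒≥ a≮d))))
  ... | inj₁ (k , e₀≡) = trans (coef-at m (𝔾._*_ (suc m) f g) e k e₀≡)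
    (trans (coef-sum m {suc k} (λ l → 𝔾._*_ m (coeffs f (toℕ l)) (coeffs g (k ℕ.∸ toℕ l))) (tail e))
    (trans (sum-cong-≋ summand) total))
    where
    T : Fin (suc k) → Carrier
    T l = coef m (coeffs f (toℕ l)) (tail e ⊖ tail a) * coef m (coeffs g (k ℕ.∸ toℕ l)) (tail a)

    position : Fin (suc k) → ℤ
    position l = start g ℤ.+ + (k ℕ.∸ toℕ l)

    complement : ∀ l → e zero ℤ.- position l ≡ start f ℤ.+ + toℕ l
    complement l = ≡.trans (≡.cong₂ (λ u v → u ℤ.- (start g ℤ.+ v)) e₀≡ (≡.sym (ℤ.⊖-≥ l≤k)))
      (≡.trans (≡.cong (λ v → start f ℤ.+ start g ℤ.+ + k ℤ.- (start g ℤ.+ v)) (≡.sym (ℤ.[+m]-[+n]≡m⊖n k (toℕ l))))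
               (regroup (start f) (start g) (+ k) (+ toℕ l)))
      where
      l≤k = ℕ.s≤s⁻¹ (Fin.toℕ<n l)
      regroup : ∀ u v k l → u ℤ.+ v ℤ.+ k ℤ.- (v ℤ.+ (k ℤ.- l)) ≡ u ℤ.+ l
      regroup = solve-∀

    at-position : ∀ l x′ → coef (suc m) f (e ⊖ (position l ∷ x′)) * coef (suc m) g (position l ∷ x′) ≈
                  coef m (coeffs f (toℕ l)) (tail e ⊖ x′) * coef m (coeffs g (k ℕ.∸ toℕ l)) x′
    at-position l x′ = *-cong (coef-at m f (e ⊖ (position l ∷ x′)) (toℕ l) (complement l))
                              (coef-at m g (position l ∷ x′) (k ℕ.∸ toℕ l) ≡.refl)

    -- Every layer `l` is reduced at the same inner exponent `tail a`, even where `position l`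
    -- differs from `a zero`; `T-off` then removes those layers.
    summand : ∀ l → coef m (𝔾._*_ m (coeffs f (toℕ l)) (coeffs g (k ℕ.∸ toℕ l))) (tail e) ≈ T l
    summand l = coef-* m _ _ (tail e) (tail a) λ x′ x′≉a →
      trans (sym (at-position l x′)) (off (position l ∷ x′) (λ x≗a → x′≉a (x≗a ∘ suc)))

    T-off : ∀ l → position l ≢ a zero → T l ≈ 0#
    T-off l pos≢ = trans (sym (at-position l (tail a))) (off (position l ∷ tail a) (λ x≗a → pos≢ (x≗a zero)))

    position-injective : ∀ l l′ → position l ≡ position l′ → l ≡ l′
    position-injective l l′ eq = Fin.toℕ-injective (ℤ.+-injective (ℤ-Ring.+-cancelˡ (start f) _ _
      (≡.trans (≡.sym (complement l)) (≡.trans (≡.cong (ℤ._-_ (e zero)) eq) (complement l′)))))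

    total : sum T ≈ coef (suc m) f (e ⊖ a) * coef (suc m) g a
    total with Fin.any? (λ l → position l ℤ.≟ a zero)
    ... | yes (l₀ , pos≡) = begin
      sum T ≈⟨ sum-single T l₀ (λ l l≢ → T-off l (λ pos → l≢ (position-injective l l₀ (≡.trans pos (≡.sym pos≡))))) ⟩
      T l₀
        ≈⟨ *-cong (coef-at m f (e ⊖ a) (toℕ l₀)
                    (≡.trans (≡.cong (ℤ._-_ (e zero)) (≡.sym pos≡)) (complement l₀)))
                  (coef-at m g a (k ℕ.∸ toℕ l₀) (≡.sym pos≡)) ⟨
      coef (suc m) f (e ⊖ a) * coef (suc m) g a ∎
    -- Stored coefficients of both series at `e zero - a zero` and `a zero` would have indices
    -- adding up to `k`, which makes `a zero` one of the positions. So one of the two exponents lies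
    -- below its start.
    ... | no nowhere = trans (sum-zero T (λ l → T-off l (λ pos → nowhere (l , pos)))) (sym rhs≈0)
      where
      rhs≈0 : coef (suc m) f (e ⊖ a) * coef (suc m) g a ≈ 0#
      rhs≈0 with offset (start f) (e zero ℤ.- a zero) | offset (start g) (a zero)
      ... | inj₂ e-a<d   | _            = trans (*-congʳ (coef-below m f (e ⊖ a) e-a<d)) (zeroˡ _)
      ... | inj₁ _       | inj₂ a<d     = trans (*-congˡ (coef-below m g a a<d)) (zeroʳ _)
      ... | inj₁ (l , l≡) | inj₁ (j , j≡) = contradiction (fromℕ< l<1+k , pos) nowhere
        where
        regroup₁ : ∀ e a → e ≡ (e ℤ.- a) ℤ.+ a
        regroup₁ = solve-∀
        regroup₂ : ∀ u l v j → u ℤ.+ l ℤ.+ (v ℤ.+ j) ≡ u ℤ.+ v ℤ.+ (l ℤ.+ j)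
        regroup₂ = solve-∀
        l+j≡k : l ℕ.+ j ≡ k
        l+j≡k = ℤ.+-injective (ℤ-Ring.+-cancelˡ (start f ℤ.+ start g) _ _
          (≡.trans (≡.sym (regroup₂ (start f) (+ l) (start g) (+ j)))
          (≡.trans (≡.sym (≡.cong₂ ℤ._+_ l≡ j≡)) (≡.trans (≡.sym (regroup₁ (e zero) (a zero))) e₀≡))))
        l<1+k : l ℕ.< suc k
        l<1+k = ℕ.s≤s (≡.subst (l ℕ.≤_) l+j≡k (ℕ.m≤m+n l j))
        pos : position (fromℕ< l<1+k) ≡ a zero
        pos = ≡.trans (≡.cong (λ z → start g ℤ.+ + z)
          (≡.trans (≡.cong₂ ℕ._∸_ (≡.sym l+j≡k) (Fin.toℕ-fromℕ< l<1+k)) (ℕ.m+n∸m≡n l j))) (≡.sym j≡)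

-- Series whose terms are indexed by lattice points

infixl 6 _⊕_
infixl 7 _·_

_⊕_ : Vector ℤ m → Vector ℤ m → Vector ℤ m
(u ⊕ v) p = u p ℤ.+ v p

_·_ : ℤ → Vector ℤ m → Vector ℤ m
(t · α) p = t ℤ.* α p

_≗?_ : (u v : Vector ℤ m) → Dec (u ≗ v)
u ≗? v = Fin.all? (λ p → u p ℤ.≟ v p)

Positive : Vector ℤ m → Set
Positive {m = m} α = ∃[ p ] (∀ q → q Fin.< p → α q ≡ +0) × +0 ℤ.< α p

multiple-unique : ∀ {q} {α : Vector ℤ m} → α q ≢ +0 → ∀ s t → (s · α) q ≡ (t · α) q → s ≡ t
multiple-unique {q = q} {α} αq≢0 s t = ℤ.*-cancelʳ-≡ s t (α q) {{ℤ.≢-nonZero αq≢0}}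

∑ℤ : Vector ℤ n → ℤ
∑ℤ = RawMonoidSum.sum ℤ.+-0-rawMonoid

∑ℤ-zero : ∀ {n} (F : Vector ℤ n) → (∀ j → F j ≡ +0) → ∑ℤ F ≡ +0
∑ℤ-zero {zero}  F F≡0 = ≡.refl
∑ℤ-zero {suc n} F F≡0 = ≡.cong₂ ℤ._+_ (F≡0 zero) (∑ℤ-zero (tail F) (F≡0 ∘ suc))

module Expansions {c ℓ} (K : CommutativeRing c ℓ) (N : ℕ) where
  open CommutativeRing K hiding (zero)
  open Coefficients K public
  open Series rawRing N
  open import Algebra.Properties.Ring ring using (-0#≈0#)

  coef-CT : ∀ m p f e → e p ≡ +0 → coef m (CT p f) e ≈ coef m f e
  coef-CT (suc m) zero    f e e₀≡0 = trans (coef-term m _ +0 e e₀≡0)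
    (coef-≡ m (≡.cong (coefficient (G m) f) (≡.sym e₀≡0)) (tail e))
  coef-CT (suc m) (suc p) f e eₚ≡0 with offset (start f) (e zero)
  ... | inj₁ (k , eq) = trans (coef-at m (CT (suc p) f) e k eq)
    (trans (coef-CT m p (coeffs f k) (tail e) eₚ≡0) (sym (coef-at m f e k eq)))
  ... | inj₂ e₀<d = trans (coef-below m (CT (suc p) f) e e₀<d) (sym (coef-below m f e e₀<d))

  coef-CT-≢ : ∀ m p f e → e p ≢ +0 → coef m (CT p f) e ≈ 0#
  coef-CT-≢ (suc m) zero    f e e₀≢0 = coef-term-≢ m _ +0 e e₀≢0
  coef-CT-≢ (suc m) (suc p) f e eₚ≢0 with offset (start f) (e zero)
  ... | inj₁ (k , eq) = trans (coef-at m (CT (suc p) f) e k eq)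
    (coef-CT-≢ m p (coeffs f k) (tail e) eₚ≢0)
  ... | inj₂ e₀<d = coef-below m (CT (suc p) f) e e₀<d

  coef-𝒵 : ∀ m p f e → + N ℤ.∣ e p → coef m (𝒵 p f) e ≈ coef m f e
  coef-𝒵 (suc m) p f e N∣e with offset (start f) (e zero)
  coef-𝒵 (suc m) zero    f e N∣e | inj₁ (k , eq) = trans (coef-at m (𝒵 {suc m} zero f) e k eq)
    (branch-elim (λ g → coef m g (tail e) ≈ coef (suc m) f e) (+ N ℤ.∣? (start f ℤ.+ + k))
      (λ _ → sym (coef-at m f e k eq))
      (λ N∤ → contradiction (≡.subst (+ N ℤ.∣_) eq N∣e) N∤))
  coef-𝒵 (suc m) (suc p) f e N∣e | inj₁ (k , eq) = trans (coef-at m (𝒵 (suc p) f) e k eq)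
    (trans (coef-𝒵 m p (coeffs f k) (tail e) N∣e) (sym (coef-at m f e k eq)))
  coef-𝒵 (suc m) zero    f e N∣e | inj₂ e₀<d =
    trans (coef-below m (𝒵 {suc m} zero f) e e₀<d) (sym (coef-below m f e e₀<d))
  coef-𝒵 (suc m) (suc p) f e N∣e | inj₂ e₀<d =
    trans (coef-below m (𝒵 (suc p) f) e e₀<d) (sym (coef-below m f e e₀<d))

  coef-𝒵-∤ : ∀ m p f e → ¬ + N ℤ.∣ e p → coef m (𝒵 p f) e ≈ 0#
  coef-𝒵-∤ (suc m) p f e N∤e with offset (start f) (e zero)
  coef-𝒵-∤ (suc m) zero    f e N∤e | inj₁ (k , eq) = trans (coef-at m (𝒵 {suc m} zero f) e k eq)
    (branch-elim (λ g → coef m g (tail e) ≈ 0#) (+ N ℤ.∣? (start f ℤ.+ + k))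
      (λ N∣ → contradiction (≡.subst (+ N ℤ.∣_) (≡.sym eq) N∣) N∤e)
      (λ _ → coef-0# m (tail e)))
  coef-𝒵-∤ (suc m) (suc p) f e N∤e | inj₁ (k , eq) = trans (coef-at m (𝒵 (suc p) f) e k eq)
    (coef-𝒵-∤ m p (coeffs f k) (tail e) N∤e)
  coef-𝒵-∤ (suc m) zero    f e N∤e | inj₂ e₀<d = coef-below m (𝒵 {suc m} zero f) e e₀<d
  coef-𝒵-∤ (suc m) (suc p) f e N∤e | inj₂ e₀<d = coef-below m (𝒵 (suc p) f) e e₀<d

  coef-monomial : ∀ m α e → e ≗ α → coef m (monomialℤ α) e ≈ 1#
  coef-monomial zero    α e e≗α = refl
  coef-monomial (suc m) α e e≗α =
    trans (coef-term m _ (α zero) e (e≗α zero)) (coef-monomial m (tail α) (tail e) (e≗α ∘ suc))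

  coef-monomial-≢ : ∀ m α e → ¬ e ≗ α → coef m (monomialℤ α) e ≈ 0#
  coef-monomial-≢ zero    α e e≇α = contradiction (λ ()) e≇α
  coef-monomial-≢ (suc m) α e e≇α with e zero ℤ.≟ α zero
  ... | no e₀≢α₀  = coef-term-≢ m _ (α zero) e e₀≢α₀
  ... | yes e₀≡α₀ = trans (coef-term m _ (α zero) e e₀≡α₀)
    (coef-monomial-≢ m (tail α) (tail e) (λ e′≗α′ → e≇α λ { zero → e₀≡α₀ ; (suc p) → e′≗α′ p }))

  monomial-0 : ∀ m → 𝔾.1# m ≡ monomialℤ {m} (λ _ → +0)
  monomial-0 zero    = ≡.refl
  monomial-0 (suc m) = ≡.cong (λ x → term (G m) x +0) (monomial-0 m)

  private
    -- The clause of `geometricℤ` for leading exponent `suc a`, named so that `coef-at` and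
    -- `coef-below` can be applied to it.
    ladder : ∀ m → Vector ℤ m → ℕ → ∣G suc m ∣
    ladder m α a = ⟨ +0 , (λ k → branch (suc a ℕ.∣? k)
                     (λ _ → monomialℤ (λ p → + (k ℕ./ suc a) ℤ.* α p)) (𝔾.0# m)) ⟩

    geometric-zero : ∀ (α : Vector ℤ (suc m)) → α zero ≡ +0 →
                     geometricℤ α ≡ term (G m) (geometricℤ (tail α)) +0
    geometric-zero α eq rewrite eq = ≡.refl

    geometric-suc : ∀ (α : Vector ℤ (suc m)) {a} → α zero ≡ +[1+ a ] →
                    geometricℤ α ≡ ladder m (tail α) a
    geometric-suc α eq rewrite eq = ≡.refl

    positive-suc : ∀ {a} → +0 ℤ.< a → ∃[ k ] a ≡ +[1+ k ]
    positive-suc {+[1+ k ]} _ = k , ≡.refl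
    positive-suc {+0} (ℤ.+<+ ())

    positive-tail : ∀ {α : Vector ℤ (suc m)} → Positive α →
                    (∃[ a ] α zero ≡ +[1+ a ]) ⊎ (α zero ≡ +0 × Positive (tail α))
    positive-tail (zero  , _    , α₀>0) = inj₁ (positive-suc α₀>0)
    positive-tail (suc p , α<≡0 , αₚ>0) =
      inj₂ (α<≡0 zero (ℕ.s≤s ℕ.z≤n) , p , (λ q q<p → α<≡0 (suc q) (ℕ.s≤s q<p)) , αₚ>0)

  coef-geometric : ∀ m (α e : Vector ℤ m) → Positive α → ∀ k → e ≗ + k · α →
                   coef m (geometricℤ α) e ≈ 1#
  coef-geometric (suc m) α e α>0 k e≗kα with positive-tail α>0
  ... | inj₁ (a , α₀≡) = trans (coef-≡ (suc m) (geometric-suc α α₀≡) e)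
    (trans (coef-at m (ladder m (tail α) a) e (k ℕ.* suc a) e₀≡)
      (branch-elim (λ g → coef m g (tail e) ≈ 1#) (suc a ℕ.∣? k ℕ.* suc a)
        (λ _ → coef-monomial m _ (tail e) (λ p → ≡.trans (e≗kα (suc p))
          (≡.cong (λ z → + z ℤ.* α (suc p)) (≡.sym (ℕ.m*n/n≡m k (suc a))))))
        (contradiction (ℕ.n∣m*n k))))
    where
    e₀≡ : e zero ≡ +0 ℤ.+ + (k ℕ.* suc a)
    e₀≡ = ≡.trans (e≗kα zero) (≡.trans (≡.cong (ℤ._*_ (+ k)) α₀≡)
      (≡.trans (≡.sym (ℤ.pos-* k (suc a))) (≡.sym (ℤ.+-identityˡ _))))
  ... | inj₂ (α₀≡0 , α′>0) = trans (coef-≡ (suc m) (geometric-zero α α₀≡0) e)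
    (trans (coef-term m _ +0 e (≡.trans (e≗kα zero) (≡.trans (≡.cong (ℤ._*_ (+ k)) α₀≡0) (ℤ.*-zeroʳ (+ k)))))
           (coef-geometric m (tail α) (tail e) α′>0 k (e≗kα ∘ suc)))

  coef-geometric-≢ : ∀ m (α e : Vector ℤ m) → Positive α → (∀ k → ¬ e ≗ + k · α) →
                     coef m (geometricℤ α) e ≈ 0#
  coef-geometric-≢ (suc m) α e α>0 e≇kα with positive-tail α>0
  ... | inj₁ (a , α₀≡) = trans (coef-≡ (suc m) (geometric-suc α α₀≡) e) outside
    where
    outside : coef (suc m) (ladder m (tail α) a) e ≈ 0#
    outside with offset +0 (e zero)
    ... | inj₂ e₀<0     = coef-below m (ladder m (tail α) a) e e₀<0
    ... | inj₁ (k , eq) = trans (coef-at m (ladder m (tail α) a) e k eq)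
      (branch-elim (λ g → coef m g (tail e) ≈ 0#) (suc a ℕ.∣? k)
        (λ a∣k → coef-monomial-≢ m _ (tail e) (λ e′≗ → e≇kα (k ℕ./ suc a)
          λ { zero → ≡.trans eq (≡.trans (ℤ.+-identityˡ (+ k))
                (≡.trans (≡.cong +_ (≡.sym (ℕ.m/n*n≡m a∣k)))
                (≡.trans (ℤ.pos-* (k ℕ./ suc a) (suc a)) (≡.cong (ℤ._*_ (+ (k ℕ./ suc a))) (≡.sym α₀≡)))))
            ; (suc p) → e′≗ p }))
        (λ _ → coef-0# m (tail e)))
  ... | inj₂ (α₀≡0 , α′>0) = trans (coef-≡ (suc m) (geometric-zero α α₀≡0) e) outside
    where
    outside : coef (suc m) (term (G m) (geometricℤ (tail α)) +0) e ≈ 0#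
    outside with e zero ℤ.≟ +0
    ... | no e₀≢0  = coef-term-≢ m _ +0 e e₀≢0
    ... | yes e₀≡0 = trans (coef-term m _ +0 e e₀≡0)
      (coef-geometric-≢ m (tail α) (tail e) α′>0 (λ k e′≗ → e≇kα k
        λ { zero → ≡.trans e₀≡0 (≡.sym (≡.trans (≡.cong (ℤ._*_ (+ k)) α₀≡0) (ℤ.*-zeroʳ (+ k))))
          ; (suc p) → e′≗ p }))

  -- A description of a series by a family of terms. The points are compared with `_≗_`, and several
  -- indices may name the same point. The field `found?` makes the description usable
  -- constructively: whether a given exponent occurs has to be decided before `hit` or `miss` can be
  -- applied.
  record Sparse m (f : ∣G m ∣) {T : Set} (point : T → Vector ℤ m) (weight : T → Carrier) : Set ℓ where
    field
      hit    : ∀ t e → e ≗ point t → coef m f e ≈ weight t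
      miss   : ∀ e → (∀ t → ¬ e ≗ point t) → coef m f e ≈ 0#
      found? : ∀ e → Dec (∃[ t ] e ≗ point t)

  open Sparse public

  private
    variable
      T U : Set

  reindex : ∀ {m} {f : ∣G m ∣} {pt : T → Vector ℤ m} {w : T → Carrier} {pt′ : U → Vector ℤ m} {w′ : U → Carrier} →
            Sparse m f pt w → (to : U → T) (from : T → U) →
            (∀ u → pt′ u ≗ pt (to u)) → (∀ t → pt t ≗ pt′ (from t)) → (∀ u → w (to u) ≈ w′ u) →
            Sparse m f pt′ w′
  reindex S to from to-pt from-pt to-w = record
    { hit    = λ u e e≗ → trans (hit S (to u) e (λ p → ≡.trans (e≗ p) (to-pt u p))) (to-w u)
    ; miss   = λ e nowhere → miss S e (λ t e≗ → nowhere (from t) (λ p → ≡.trans (e≗ p) (from-pt t p)))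
    ; found? = λ e → Dec.map′ (λ { (t , e≗) → from t , λ p → ≡.trans (e≗ p) (from-pt t p) })
                              (λ { (u , e≗) → to u , λ p → ≡.trans (e≗ p) (to-pt u p) }) (found? S e)
    }

  sparse-monomial : ∀ {m} α → Sparse m (monomialℤ α) {⊤} (λ _ → α) (λ _ → 1#)
  sparse-monomial α = record
    { hit    = λ _ e → coef-monomial _ α e
    ; miss   = λ e nowhere → coef-monomial-≢ _ α e (nowhere tt)
    ; found? = λ e → Dec.map′ (tt ,_) proj₂ (e ≗? α)
    }

  sparse-neg : ∀ {m} {f : ∣G m ∣} {pt : T → Vector ℤ m} {w : T → Carrier} →
               Sparse m f pt w → Sparse m (𝔾.-_ m f) pt (λ t → - w t)
  sparse-neg {m = m} {f} S = record
    { hit    = λ t e e≗ → trans (coef-neg m f e) (-‿cong (hit S t e e≗))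
    ; miss   = λ e nowhere → trans (coef-neg m f e) (trans (-‿cong (miss S e nowhere)) -0#≈0#)
    ; found? = found? S
    }

  -- Injectivity says that the sum of two points determines the second one, which is the single-pair
  -- hypothesis of `coef-*`. Decidability for the sums is asked for separately, since deciding it
  -- from the two factors would be a search through infinitely many splittings.
  sparse-* : ∀ {m} {f g : ∣G m ∣} {pt : T → Vector ℤ m} {w : T → Carrier} {pt′ : U → Vector ℤ m} {w′ : U → Carrier} →
             Sparse m f pt w → Sparse m g pt′ w′ →
             (∀ t t′ u u′ → pt t ⊕ pt′ u ≗ pt t′ ⊕ pt′ u′ → pt′ u ≗ pt′ u′) →
             (∀ e → Dec (∃[ tu ] e ≗ pt (proj₁ tu) ⊕ pt′ (proj₂ tu))) →
             Sparse m (𝔾._*_ m f g) {T × U} (λ tu → pt (proj₁ tu) ⊕ pt′ (proj₂ tu))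
                    (λ tu → w (proj₁ tu) * w′ (proj₂ tu))
  sparse-* {m = m} {f = f} {g = g} {pt = pt} {w} {pt′} {w′} S S′ injective dec = record
    { hit    = λ { (t , u) e e≗ → trans
        (coef-* m f g e (pt′ u) (λ x x≇ → vanish e x λ t′ u′ e≗′ x≗ → x≇ λ p →
          ≡.trans (x≗ p) (≡.sym (injective t t′ u u′ (λ p → ≡.trans (≡.sym (e≗ p)) (e≗′ p)) p))))
        (*-cong (hit S t (e ⊖ pt′ u) (λ p → ≡.trans (≡.cong (ℤ._- pt′ u p) (e≗ p)) (regroup₁ (pt t p) (pt′ u p))))
                (hit S′ u (pt′ u) (λ _ → ≡.refl))) }
    -- No pair contributes here, so any exponent can be singled out in `coef-*`; `e` is an arbitrary
    -- choice.
    ; miss   = λ e nowhere → trans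
        (coef-* m f g e e (λ x _ → vanish e x λ t u e≗ _ → nowhere (t , u) e≗))
        (vanish e e λ t u e≗ _ → nowhere (t , u) e≗)
    ; found? = dec
    }
    where
    regroup₁ : ∀ a b → a ℤ.+ b ℤ.- b ≡ a
    regroup₁ = solve-∀
    regroup₂ : ∀ e x → e ≡ (e ℤ.- x) ℤ.+ x
    regroup₂ = solve-∀
    vanish : ∀ e x → (∀ t u → e ≗ pt t ⊕ pt′ u → ¬ x ≗ pt′ u) → coef m f (e ⊖ x) * coef m g x ≈ 0#
    vanish e x nowhere with found? S (e ⊖ x) | found? S′ x
    ... | no nowhere₁       | _             = trans (*-congʳ (miss S (e ⊖ x) λ t h → nowhere₁ (t , h))) (zeroˡ _)
    ... | yes _          | no nowhere₂      = trans (*-congˡ (miss S′ x λ u h → nowhere₂ (u , h))) (zeroʳ _)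
    ... | yes (t , e-x≗) | yes (u , x≗)  = contradiction x≗
      (nowhere t u λ p → ≡.trans (regroup₂ (e p) (x p)) (≡.cong₂ ℤ._+_ (e-x≗ p) (x≗ p)))

  sparse-shift : ∀ {m} {g : ∣G m ∣} α {pt : U → Vector ℤ m} {w : U → Carrier} → Sparse m g pt w →
                 Sparse m (𝔾._*_ m (monomialℤ α) g) (λ u → α ⊕ pt u) w
  sparse-shift {m = m} α {pt} S = reindex
    (sparse-* (sparse-monomial α) S
      (λ _ _ u u′ eq p → ℤ-Ring.+-cancelˡ (α p) (pt u p) (pt u′ p) (eq p))
      (λ e → Dec.map′
        (λ { (u , e≗) → (tt , u) , λ p → ≡.trans (regroup₁ (e p) (α p)) (≡.cong (ℤ._+_ (α p)) (e≗ p)) })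
        (λ { ((_ , u) , e≗) → u , λ p → ≡.trans (≡.cong (ℤ._- α p) (e≗ p)) (regroup₂ (α p) (pt u p)) })
        (found? S (e ⊖ α))))
    (tt ,_) proj₂ (λ _ _ → ≡.refl) (λ _ _ → ≡.refl) (λ _ → *-identityˡ _)
    where
    regroup₁ : ∀ e a → e ≡ a ℤ.+ (e ℤ.- a)
    regroup₁ = solve-∀
    regroup₂ : ∀ a b → a ℤ.+ b ℤ.- a ≡ b
    regroup₂ = solve-∀

  -- χ true and χ false are the coefficients of the expansions of 1 / (1 - x) for small and for large x.
  χ : Bool → ℤ → Carrier
  χ true  (+ _)    = 1#
  χ true  -[1+ _ ] = 0#
  χ false (+ _)    = 0#
  χ false -[1+ _ ] = - 1#

  multiple? : ∀ (α : Vector ℤ m) q → α q ≢ +0 → ∀ e → Dec (∃[ t ] e ≗ t · α)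
  multiple? α q αq≢0 e with α q ℤ.∣? e q
  ... | no ∤ = no λ { (t , e≗) → ∤ (ℤ.divides t (e≗ q)) }
  ... | yes (ℤ.divides t eq) with e ≗? (t · α)
  ...   | yes e≗ = yes (t , e≗)
  ...   | no e≇  = no λ { (t′ , e≗) → e≇ λ p → ≡.trans (e≗ p) (≡.cong (ℤ._* α p)
                     (multiple-unique {α = α} αq≢0 t′ t (≡.trans (≡.sym (e≗ q)) eq))) }

  -- The index runs over all integers, the negative ones having weight zero. Thus the small and the
  -- large expansion share index set and points and differ only in the weight `χ`.
  sparse-small : ∀ {m} (α : Vector ℤ m) q → α q ≢ +0 → Positive α →
                 Sparse m (geometricℤ α) (_· α) (χ true)
  sparse-small {m = m} α q αq≢0 α>0 = record
    { hit    = λ { (+ k) e → coef-geometric m α e α>0 k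
                 ; -[1+ j ] e e≗ → coef-geometric-≢ m α e α>0 λ k e≗′ →
                     contradiction (multiple-unique {α = α} αq≢0 -[1+ j ] (+ k) (≡.trans (≡.sym (e≗ q)) (e≗′ q)))
                       λ () }
    ; miss   = λ e nowhere → coef-geometric-≢ m α e α>0 (nowhere ∘ +_)
    ; found? = multiple? α q αq≢0
    }

  sparse-large : ∀ {m} (α β : Vector ℤ m) q → β q ≢ +0 → (∀ p → β p ≡ ℤ.- α p) → Positive β →
                 Sparse m (𝔾.-_ m (𝔾._*_ m (monomialℤ β) (geometricℤ β))) (_· α) (χ false)
  sparse-large α β q βq≢0 β≡-α β>0 = reindex
    (sparse-neg (sparse-shift β (sparse-small β q βq≢0 β>0))) reflect reflect
    (λ t p → ≡.trans (points t (α p)) (≡.cong (λ z → z ℤ.+ reflect t ℤ.* z) (≡.sym (β≡-α p))))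
    (λ t p → ≡.trans (≡.cong (λ z → z ℤ.+ t ℤ.* z) (β≡-α p)) (points′ t (α p)))
    λ { (+ zero) → -0#≈0# ; (+ suc _) → -0#≈0# ; -[1+ _ ] → refl }
    where
    -- This is t ↦ -1 - t: the term x^(-1) (x^(-1))^u has exponent -1 - u in x. Being an involution,
    -- it serves as both index maps of `reindex`.
    reflect : ℤ → ℤ
    reflect (+ k)    = -[1+ k ]
    reflect -[1+ k ] = + k
    reflect-≡ : ∀ t → reflect t ≡ ℤ.- (ℤ.1ℤ ℤ.+ t)
    reflect-≡ (+ k)    = ≡.refl
    reflect-≡ -[1+ zero ]  = ≡.refl
    reflect-≡ -[1+ suc k ] = ≡.refl
    points : ∀ t a → t ℤ.* a ≡ ℤ.- a ℤ.+ reflect t ℤ.* ℤ.- a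
    points t a = ≡.trans (regroup t a) (≡.cong (λ z → ℤ.- a ℤ.+ z ℤ.* ℤ.- a) (≡.sym (reflect-≡ t)))
      where
      regroup : ∀ t a → t ℤ.* a ≡ ℤ.- a ℤ.+ ℤ.- (ℤ.1ℤ ℤ.+ t) ℤ.* ℤ.- a
      regroup = solve-∀
    points′ : ∀ t a → ℤ.- a ℤ.+ t ℤ.* ℤ.- a ≡ reflect t ℤ.* a
    points′ t a = ≡.trans (regroup t a) (≡.cong (ℤ._* a) (≡.sym (reflect-≡ t)))
      where
      regroup : ∀ t a → ℤ.- a ℤ.+ t ℤ.* ℤ.- a ≡ ℤ.- (ℤ.1ℤ ℤ.+ t) ℤ.* a
      regroup = solve-∀

  -- The coordinate `q` sees only the first factor, so `t` can be read off there. This yields both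
  -- the injectivity and the decidability that `sparse-*` requires.
  sparse-times : ∀ {m} {f g : ∣G m ∣} (α : Vector ℤ m) q → α q ≢ +0 →
                 {w : ℤ → Carrier} {pt : U → Vector ℤ m} {w′ : U → Carrier} →
                 (∀ u → pt u q ≡ +0) → Sparse m f (_· α) w → Sparse m g pt w′ →
                 Sparse m (𝔾._*_ m f g) {ℤ × U} (λ tu → proj₁ tu · α ⊕ pt (proj₂ tu))
                        (λ tu → w (proj₁ tu) * w′ (proj₂ tu))
  sparse-times {m = m} α q αq≢0 {pt = pt} ptq≡0 S S′ = sparse-* S S′ injective dec
    where
    at-q : ∀ t u → (t · α ⊕ pt u) q ≡ (t · α) q
    at-q t u = ≡.trans (≡.cong (ℤ._+_ (t ℤ.* α q)) (ptq≡0 u)) (ℤ.+-identityʳ _)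
    first-unique : ∀ t t′ u u′ → (t · α ⊕ pt u) q ≡ (t′ · α ⊕ pt u′) q → t ≡ t′
    first-unique t t′ u u′ eq =
      multiple-unique {α = α} αq≢0 t t′ (≡.trans (≡.sym (at-q t u)) (≡.trans eq (at-q t′ u′)))
    injective : ∀ t t′ u u′ → t · α ⊕ pt u ≗ t′ · α ⊕ pt u′ → pt u ≗ pt u′
    injective t t′ u u′ eq p = ℤ-Ring.+-cancelˡ (t ℤ.* α p) (pt u p) (pt u′ p)
      (≡.trans (eq p) (≡.cong (λ z → z ℤ.* α p ℤ.+ pt u′ p) (≡.sym (first-unique t t′ u u′ (eq q)))))
    regroup₁ : ∀ e a → e ≡ a ℤ.+ (e ℤ.- a)
    regroup₁ = solve-∀
    regroup₂ : ∀ a b → a ℤ.+ b ℤ.- a ≡ b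
    regroup₂ = solve-∀
    dec : ∀ e → Dec (∃[ tu ] e ≗ proj₁ tu · α ⊕ pt (proj₂ tu))
    dec e with α q ℤ.∣? e q
    ... | no ∤ = no λ { ((t , u) , e≗) → ∤ (ℤ.divides t (≡.trans (e≗ q) (at-q t u))) }
    ... | yes (ℤ.divides t eq) with found? S′ (e ⊖ t · α)
    ...   | yes (u , e≗) = yes ((t , u) , λ p →
              ≡.trans (regroup₁ (e p) (t ℤ.* α p)) (≡.cong (ℤ._+_ (t ℤ.* α p)) (e≗ p)))
    ...   | no nowhere      = no λ { ((t′ , u) , e≗) → nowhere (u , λ p → ≡.trans
              (≡.cong₂ ℤ._-_ (e≗ p) (≡.cong (ℤ._* α p) (multiple-unique {α = α} αq≢0 t t′
                (≡.trans (≡.sym eq) (≡.trans (e≗ q) (at-q t′ u))))))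
              (regroup₂ (t′ ℤ.* α p) (pt u p))) }

  -- Each factor has a private coordinate `q j`, on which the other vectors vanish, so the factors
  -- can be multiplied on one at a time by `sparse-times`. Indexing by all of `Vector ℤ n`, with
  -- zero vectors outside `P`, lets the same `t` index a bracket before and after a pivot.
  sparse-product : ∀ {m p n} {P : Pred (Fin n) p} (P? : Decidable P) (h : ∀ j → P j → ∣G m ∣)
                   (α : Fin n → Vector ℤ m) (q : Fin n → Fin m) (s : Fin n → Bool) →
                   (∀ j (Pj : P j) → Sparse m (h j Pj) (_· α j) (χ (s j))) →
                   (∀ j → P j → α j (q j) ≢ +0) →
                   (∀ i j → P j → i ≢ j → α i (q j) ≡ +0) →
                   (∀ j → ¬ P j → ∀ p → α j p ≡ +0) →
                   Sparse m (foldOver (𝔾.*-rawMonoid m) P? h) {Vector ℤ n}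
                     (λ t p → ∑ℤ (λ j → t j ℤ.* α j p))
                     (λ t → foldOver *-rawMonoid P? (λ j _ → χ (s j) (t j)))
  sparse-product {m = m} {n = zero} P? h α q s S diagonal off outside =
    ≡.subst (λ f → Sparse m f {Vector ℤ 0} (λ _ _ → +0) (λ _ → 1#)) (≡.sym (monomial-0 m))
      (reindex (sparse-monomial (λ _ → +0)) (λ _ → tt) (λ _ ()) (λ _ _ → ≡.refl) (λ _ _ → ≡.refl) (λ _ → refl))
  sparse-product {m = m} {n = suc n} P? h α q s S diagonal off outside
    with P? zero | sparse-product {m = m} (P? ∘ suc) (h ∘ suc) (α ∘ suc) (q ∘ suc) (s ∘ suc) (S ∘ suc) (diagonal ∘ suc)
                                  (λ i j Pj i≢j → off (suc i) (suc j) Pj (i≢j ∘ Fin.suc-injective)) (outside ∘ suc)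
  ... | yes P₀ | IH = reindex
    (sparse-times (α zero) (q zero) (diagonal zero P₀)
      (λ t → ∑ℤ-zero (λ j → t j ℤ.* α (suc j) (q zero))
        (λ j → ≡.trans (≡.cong (ℤ._*_ (t j)) (off (suc j) zero P₀ λ ())) (ℤ.*-zeroʳ (t j))))
      (S zero P₀) IH)
    (λ t → t zero , tail t) (λ { (t₀ , t) → t₀ ∷ t })
    (λ _ _ → ≡.refl) (λ _ _ → ≡.refl) (λ _ → refl)
  ... | no ¬P₀ | IH = ≡.subst
    (λ x → Sparse m (𝔾._*_ m x (foldOver (𝔾.*-rawMonoid m) (P? ∘ suc) (h ∘ suc)))
             (λ t p → ∑ℤ (λ j → t j ℤ.* α j p))
             (λ t → 1# * foldOver *-rawMonoid (P? ∘ suc) (λ j _ → χ (s (suc j)) (t (suc j)))))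
    (≡.sym (monomial-0 m))
    -- The coordinate of `t` at a column outside `P` affects neither the point nor the weight;
    -- `+0 ∷_` picks a value for it.
    (reindex (sparse-shift (λ _ → +0) IH) tail (+0 ∷_)
      (λ t p → ≡.cong (ℤ._+ ∑ℤ (λ j → t (suc j) ℤ.* α (suc j) p))
        (≡.trans (≡.cong (ℤ._*_ (t zero)) (outside zero ¬P₀ p)) (ℤ.*-zeroʳ (t zero))))
      (λ _ _ → ≡.refl)
      (λ _ → sym (*-identityˡ _)))

-- Telescoping over the cuts of a line

-- above i j says that j lies above i; only the active elements have a position on the line.  A cut
-- is given by the elements above it.
record Line {n} (active : Fin n → Bool) (above : Fin n → Fin n → Bool) : Set where
  field
    asymmetric : ∀ i j → active i ≡ true → active j ≡ true → i ≢ j → above j i ≡ not (above i j)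
    transitive : ∀ i j k → active i ≡ true → active j ≡ true → active k ≡ true →
                 above i j ≡ true → above j k ≡ true → above i k ≡ true

UpClosed : (Fin n → Bool) → (Fin n → Fin n → Bool) → (Fin n → Bool) → Set
UpClosed active above cut =
  ∀ i j → active i ≡ true → active j ≡ true → above i j ≡ true → cut i ≡ true → cut j ≡ true

module Telescoping {c ℓ} (R : CommutativeSemiring c ℓ) where
  open CommutativeSemiring R hiding (zero)
  open import Algebra.Properties.Semiring.Sum semiring
    using (sum; sum-cong-≋; *-distribˡ-sum; ∑-distrib-+)
  open import Algebra.Properties.CommutativeSemigroup *-commutativeSemigroup using (x∙yz≈y∙xz)
  open import Relation.Binary.Reasoning.Setoid setoid

  ∏ : (Fin n → Carrier) → Carrier
  ∏ = RawMonoidSum.sum *-rawMonoid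

  omit : (Fin n → Carrier) → Fin n → Carrier
  omit F j = ∏ (λ s → if does (s Fin.≟ j) then 1# else F s)

  module _ (active : Fin n → Bool) (above : Fin n → Fin n → Bool) (x : Fin n → Bool → Carrier)
           (σ : Fin n → Carrier) (lower upper : Fin n → Bool) where

    between : Fin n → Bool
    between j = active j ∧ (lower j ∧ not (upper j))

    -- The product at the cut through `j` itself: `j` is on neither side, and `σ j` takes the place
    -- of its factor.
    jump : Fin n → Carrier
    jump j = if between j then σ j * omit (λ s → x s (above j s)) j else 0#

  private
    if-cong : ∀ b {u v : Carrier} → (b ≡ true → u ≈ v) → (if b then u else 0#) ≈ (if b then v else 0#)
    if-cong true  h = h ≡.refl
    if-cong false h = refl

    *-if : ∀ b u v → (if b then u * v else 0#) ≈ u * (if b then v else 0#)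
    *-if true  u v = refl
    *-if false u v = sym (zeroʳ u)

  -- Moving the cut downwards past the element j changes the product from having the factor
  -- x j false to having x j true, which adds σ j times the product of the other factors.
  telescope : ∀ {n} (active : Fin n → Bool) above (x : Fin n → Bool → Carrier) (σ : Fin n → Carrier)
              lower upper → Line active above →
              (∀ j → active j ≡ true → σ j + x j false ≈ x j true) →
              (∀ j → active j ≡ false → x j false ≈ x j true) →
              UpClosed active above lower → UpClosed active above upper →
              (∀ j → active j ≡ true → upper j ≡ true → lower j ≡ true) →
              sum (jump active above x σ lower upper) + ∏ (λ s → x s (upper s)) ≈ ∏ (λ s → x s (lower s))
  telescope {zero} active above x σ lower upper line rise still low up below = +-identityˡ 1#
  telescope {suc n} active above x σ lower upper line rise still low up below =
    split (active zero) (lower zero) (upper zero) ≡.refl ≡.refl ≡.refl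
    where
    open Line line
    act′ = active ∘ suc
    above′ : Fin n → Fin n → Bool
    above′ i j = above (suc i) (suc j)
    x′ = x ∘ suc
    σ′ = σ ∘ suc
    low′ = lower ∘ suc
    up′ = upper ∘ suc
    mid : Fin n → Bool
    mid s = above zero (suc s)
    F : (Fin n → Bool) → Carrier
    F cut = ∏ (λ s → x′ s (cut s))

    IH : ∀ l u → UpClosed act′ above′ l → UpClosed act′ above′ u →
         (∀ j → act′ j ≡ true → u j ≡ true → l j ≡ true) →
         sum (jump act′ above′ x′ σ′ l u) + F u ≈ F l
    IH l u = telescope act′ above′ x′ σ′ l u
      (record { asymmetric = λ i j ai aj i≢j → asymmetric (suc i) (suc j) ai aj (i≢j ∘ Fin.suc-injective)
              ; transitive = λ i j k → transitive (suc i) (suc j) (suc k) })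
      (rise ∘ suc) (still ∘ suc)

    low′-up : UpClosed act′ above′ low′
    low′-up i j = low (suc i) (suc j)
    up′-up : UpClosed act′ above′ up′
    up′-up i j = up (suc i) (suc j)

    rest : Fin n → Carrier
    rest j = σ′ j * omit (λ s → x′ s (above′ j s)) j

    terms = jump active above x σ lower upper

    Goal : Set ℓ
    Goal = sum terms + ∏ (λ s → x s (upper s)) ≈ ∏ (λ s → x s (lower s))

    -- Element zero lies outside the range, so all cuts of the range are on the same side of it. Its
    -- factor is a constant `d`, which comes out of the induction hypothesis.
    outside : ∀ d → between active above x σ lower upper zero ≡ false →
              x zero (lower zero) ≈ d → x zero (upper zero) ≈ d →
              (∀ j → between act′ above′ x′ σ′ low′ up′ j ≡ true → x zero (above (suc j) zero) ≈ d) → Goal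
    outside d b₀ xl xu xj = begin
      terms zero + sum (terms ∘ suc) + x zero (upper zero) * F up′
        ≈⟨ +-cong (+-cong (reflexive (≡.cong (λ b → if b then _ else 0#) b₀)) (sum-cong-≋ summand)) (*-congʳ xu) ⟩
      0# + sum (λ j → d * jump act′ above′ x′ σ′ low′ up′ j) + d * F up′
        ≈⟨ +-congʳ (+-identityˡ _) ⟩
      sum (λ j → d * jump act′ above′ x′ σ′ low′ up′ j) + d * F up′
        ≈⟨ +-congʳ (*-distribˡ-sum d (jump act′ above′ x′ σ′ low′ up′)) ⟨
      d * sum (jump act′ above′ x′ σ′ low′ up′) + d * F up′
        ≈⟨ distribˡ d _ _ ⟨
      d * (sum (jump act′ above′ x′ σ′ low′ up′) + F up′)
        ≈⟨ *-cong (sym xl) (IH low′ up′ low′-up up′-up (below ∘ suc)) ⟩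
      x zero (lower zero) * F low′ ∎
      where
      summand : ∀ j → terms (suc j) ≈ d * jump act′ above′ x′ σ′ low′ up′ j
      summand j = trans
        (if-cong (between act′ above′ x′ σ′ low′ up′ j) λ b → trans (*-congˡ (*-congʳ (xj j b))) (x∙yz≈y∙xz _ _ _))
        (*-if (between act′ above′ x′ σ′ low′ up′ j) d (rest j))

    -- The range is split at `mid`, the cut through element zero. Elements below it see zero above
    -- them and carry the factor `A`, those above it carry `B`. The induction hypothesis is used on
    -- both halves, and `σ zero + B ≈ A` joins them at `F mid`.
    inside : active zero ≡ true → lower zero ≡ true → upper zero ≡ false → Goal
    inside a₀ l₀ u₀ = begin
      terms zero + sum (terms ∘ suc) + x zero (upper zero) * F up′
        ≈⟨ +-cong (+-cong first (trans (sum-cong-≋ summand) sums)) (*-congʳ (reflexive (≡.cong (x zero) u₀))) ⟩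
      σ zero * F mid + (A * Σ₁ + B * Σ₂) + B * F up′  ≈⟨ +-congʳ (+-assoc _ _ _) ⟨
      σ zero * F mid + A * Σ₁ + B * Σ₂ + B * F up′    ≈⟨ +-assoc _ _ _ ⟩
      σ zero * F mid + A * Σ₁ + (B * Σ₂ + B * F up′)  ≈⟨ +-cong (+-comm _ _) (trans (sym (distribˡ B _ _)) (*-congˡ upper-part)) ⟩
      A * Σ₁ + σ zero * F mid + B * F mid             ≈⟨ +-assoc _ _ _ ⟩
      A * Σ₁ + (σ zero * F mid + B * F mid)           ≈⟨ +-congˡ (trans (sym (distribʳ _ _ _)) (*-congʳ (rise zero a₀))) ⟩
      A * Σ₁ + A * F mid                              ≈⟨ distribˡ A _ _ ⟨
      A * (Σ₁ + F mid)                                ≈⟨ *-cong (reflexive (≡.cong (x zero) (≡.sym l₀))) lower-part ⟩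
      x zero (lower zero) * F low′                    ∎
      where
      A = x zero true
      B = x zero false
      J₁ = jump act′ above′ x′ σ′ low′ mid
      J₂ = jump act′ above′ x′ σ′ mid up′
      Σ₁ = sum J₁
      Σ₂ = sum J₂

      -- Were `j` above the upper cut but not above zero, then zero would be above `j`, and hence
      -- above the upper cut too.
      above-upper : ∀ j → act′ j ≡ true → up′ j ≡ true → mid j ≡ true
      above-upper j aj uj with above zero (suc j) in eq
      ... | true  = ≡.refl
      ... | false = contradiction
        (≡.trans (≡.sym u₀) (up (suc j) zero aj a₀ (≡.trans (asymmetric zero (suc j) a₀ aj λ ()) (≡.cong not eq)) uj))
        λ ()

      below-lower : ∀ j → act′ j ≡ true → mid j ≡ true → low′ j ≡ true
      below-lower j aj mj = low zero (suc j) a₀ aj mj l₀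

      mid-up : UpClosed act′ above′ mid
      mid-up i j ai aj ij mi = transitive zero (suc i) (suc j) a₀ ai aj mi ij

      lower-part : Σ₁ + F mid ≈ F low′
      lower-part = IH low′ mid low′-up mid-up below-lower

      upper-part : Σ₂ + F up′ ≈ F mid
      upper-part = IH mid up′ mid-up up′-up above-upper

      first : terms zero ≈ σ zero * F mid
      first rewrite a₀ | l₀ | u₀ = *-congˡ (*-identityˡ _)

      sums : sum (λ j → A * J₁ j + B * J₂ j) ≈ A * Σ₁ + B * Σ₂
      sums = trans (∑-distrib-+ (λ j → A * J₁ j) (λ j → B * J₂ j))
                   (+-cong (sym (*-distribˡ-sum A J₁)) (sym (*-distribˡ-sum B J₂)))

      summand : ∀ j → terms (suc j) ≈ A * J₁ j + B * J₂ j
      summand j with active (suc j) in aj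
      ... | false = sym (trans (+-cong (zeroʳ A) (zeroʳ B)) (+-identityˡ 0#))
      ... | true with above zero (suc j) in mj | asymmetric zero (suc j) a₀ aj (λ ())
      ...   | true | j0 rewrite below-lower j aj mj | j0 =
        trans (trans (if-cong (not (upper (suc j))) λ _ → x∙yz≈y∙xz _ _ _) (*-if (not (upper (suc j))) B (rest j)))
              (sym (trans (+-congʳ (zeroʳ A)) (+-identityˡ _)))
      ...   | false | j0 with upper (suc j) in uj
      ...     | true  = contradiction (≡.trans (≡.sym mj) (above-upper j aj uj)) λ ()
      ...     | false rewrite j0 =
        trans (trans (if-cong (lower (suc j) ∧ true) λ _ → x∙yz≈y∙xz _ _ _) (*-if (lower (suc j) ∧ true) A (rest j)))
              (sym (trans (+-congˡ (zeroʳ B)) (+-identityʳ _)))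

    ∧-true : ∀ a {b} → a ∧ b ≡ true → a ≡ true
    ∧-true true _ = ≡.refl

    between-active : ∀ j → between act′ above′ x′ σ′ low′ up′ j ≡ true → act′ j ≡ true
    between-active j = ∧-true (act′ j)

    between-lower : ∀ j → between act′ above′ x′ σ′ low′ up′ j ≡ true → low′ j ≡ true
    between-lower j b with act′ j
    ... | true = ∧-true (low′ j) b

    between-upper : ∀ j → between act′ above′ x′ σ′ low′ up′ j ≡ true → up′ j ≡ false
    between-upper j b with act′ j | low′ j | up′ j
    ... | true | true | false = ≡.refl

    split : ∀ a l u → active zero ≡ a → lower zero ≡ l → upper zero ≡ u → Goal
    split false _ _ a₀ _ _ = outside (x zero true) (≡.cong (_∧ _) a₀) (constant _) (constant _) (λ j _ → constant _)
      where
      constant : ∀ b → x zero b ≈ x zero true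
      constant true  = refl
      constant false = still zero a₀
    split true true false a₀ l₀ u₀ = inside a₀ l₀ u₀
    split true false true a₀ l₀ u₀ = contradiction (≡.trans (≡.sym l₀) (below zero a₀ u₀)) λ ()
    split true true true a₀ l₀ u₀ = outside (x zero true) (≡.cong₂ _∧_ a₀ (≡.cong₂ _∧_ l₀ (≡.cong not u₀)))
      (reflexive (≡.cong (x zero) l₀)) (reflexive (≡.cong (x zero) u₀))
      (λ j b → reflexive (≡.cong (x zero) (beyond j b)))
      where
      beyond : ∀ j → between act′ above′ x′ σ′ low′ up′ j ≡ true → above (suc j) zero ≡ true
      beyond j b with above zero (suc j) in eq | asymmetric zero (suc j) a₀ (between-active j b) (λ ())
      ... | false | j0 = j0
      ... | true  | _  = contradiction
        (≡.trans (≡.sym (between-upper j b)) (up zero (suc j) a₀ (between-active j b) eq u₀)) λ ()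
    split true false false a₀ l₀ u₀ = outside (x zero false) (≡.cong₂ _∧_ a₀ (≡.cong (_∧ _) l₀))
      (reflexive (≡.cong (x zero) l₀)) (reflexive (≡.cong (x zero) u₀))
      (λ j b → reflexive (≡.cong (x zero) (beyond j b)))
      where
      beyond : ∀ j → between act′ above′ x′ σ′ low′ up′ j ≡ true → above (suc j) zero ≡ false
      beyond j b with above (suc j) zero in eq
      ... | false = ≡.refl
      ... | true  = contradiction
        (≡.trans (≡.sym l₀) (low (suc j) zero (between-active j b) a₀ eq (between-lower j b))) λ ()

-- The lexicographic order on exponent vectors

small-cong : ∀ {α β : Vector ℚ m} → α ≗ β → Small α → Small β
small-cong α≗β (p , α<≡0 , αₚ>0) =
  p , (λ q q<p → ≡.trans (≡.sym (α≗β q)) (α<≡0 q q<p)) , ≡.subst (0ℚ ℚ.<_) (α≗β p) αₚ>0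

small-or-large : ∀ (α : Vector ℚ m) q → α q ≢ 0ℚ → Small α ⊎ Large α
small-or-large {suc m} α q αq≢0 with ℚ.<-cmp (α zero) 0ℚ
... | tri< α₀<0 _ _ = inj₂ (zero , (λ _ ()) , α₀<0)
... | tri> _ _ α₀>0 = inj₁ (zero , (λ _ ()) , α₀>0)
small-or-large {suc m} α zero    αq≢0 | tri≈ _ α₀≡0 _ = contradiction α₀≡0 αq≢0
small-or-large {suc m} α (suc q) αq≢0 | tri≈ _ α₀≡0 _ =
  Sum.map (λ { (p , α<≡0 , αₚ>0) → suc p , extend p α<≡0 , αₚ>0 })
          (λ { (p , α<≡0 , αₚ<0) → suc p , extend p α<≡0 , αₚ<0 })
          (small-or-large (tail α) q αq≢0)
  where
  extend : ∀ p → (∀ q → q Fin.< p → α (suc q) ≡ 0ℚ) → ∀ q → q Fin.< suc p → α q ≡ 0ℚ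
  extend p α<≡0 zero    _   = α₀≡0
  extend p α<≡0 (suc q) q<p = α<≡0 q (ℕ.s≤s⁻¹ q<p)

small⇒¬large : ∀ {α : Vector ℚ m} → Small α → ¬ Large α
small⇒¬large (p , α<p≡0 , αp>0) (q , α<q≡0 , αq<0) with Fin.<-cmp p q
... | tri< p<q _ _ = ℚ.<-irrefl (≡.sym (α<q≡0 p p<q)) αp>0
... | tri> _ _ q<p = ℚ.<-irrefl (α<p≡0 q q<p) αq<0
... | tri≈ _ ≡.refl _ = ℚ.<-asym αp>0 αq<0

small-+ : ∀ {α β : Vector ℚ m} → Small α → Small β → Small (λ p → α p ℚ.+ β p)
small-+ {α = α} {β} (p , α<≡0 , αp>0) (q , β<≡0 , βq>0) with Fin.<-cmp p q
... | tri< p<q _ _ = p , (λ r r<p → ≡.cong₂ ℚ._+_ (α<≡0 r r<p) (β<≡0 r (Fin.<-trans r<p p<q))) ,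
  ≡.subst (0ℚ ℚ.<_) (≡.sym (≡.trans (≡.cong (ℚ._+_ (α p)) (β<≡0 p p<q)) (ℚ.+-identityʳ (α p)))) αp>0
... | tri> _ _ q<p = q , (λ r r<q → ≡.cong₂ ℚ._+_ (α<≡0 r (Fin.<-trans r<q q<p)) (β<≡0 r r<q)) ,
  ≡.subst (0ℚ ℚ.<_) (≡.sym (≡.trans (≡.cong (ℚ._+ β q) (α<≡0 q q<p)) (ℚ.+-identityˡ (β q)))) βq>0
... | tri≈ _ ≡.refl _ = p , (λ r r<p → ≡.cong₂ ℚ._+_ (α<≡0 r r<p) (β<≡0 r r<p)) , ℚ.+-mono-< αp>0 βq>0

private
  *-zero : ∀ c {a} → a ≡ 0ℚ → c ℚ.* a ≡ 0ℚ
  *-zero c a≡0 = ≡.trans (≡.cong (c ℚ.*_) a≡0) (ℚ.*-zeroʳ c)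

small-*-pos : ∀ {c} {α : Vector ℚ m} → 0ℚ ℚ.< c → Small α → Small (λ p → c ℚ.* α p)
small-*-pos {c = c} {α} c>0 (p , α<≡0 , αp>0) = p , (λ q q<p → *-zero c (α<≡0 q q<p)) ,
  ≡.subst (ℚ._< c ℚ.* α p) (ℚ.*-zeroʳ c) (ℚ.*-monoʳ-<-pos c {{ℚ.positive c>0}} αp>0)

large-*-pos : ∀ {c} {α : Vector ℚ m} → 0ℚ ℚ.< c → Large α → Large (λ p → c ℚ.* α p)
large-*-pos {c = c} {α} c>0 (p , α<≡0 , αp<0) = p , (λ q q<p → *-zero c (α<≡0 q q<p)) ,
  ≡.subst (c ℚ.* α p ℚ.<_) (ℚ.*-zeroʳ c) (ℚ.*-monoʳ-<-pos c {{ℚ.positive c>0}} αp<0)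

large-*-neg : ∀ {c} {α : Vector ℚ m} → c ℚ.< 0ℚ → Small α → Large (λ p → c ℚ.* α p)
large-*-neg {c = c} {α} c<0 (p , α<≡0 , αp>0) = p , (λ q q<p → *-zero c (α<≡0 q q<p)) ,
  ≡.subst (c ℚ.* α p ℚ.<_) (ℚ.*-zeroʳ c) (ℚ.*-monoʳ-<-neg c {{ℚ.negative c<0}} αp>0)

small-*-neg : ∀ {c} {α : Vector ℚ m} → c ℚ.< 0ℚ → Large α → Small (λ p → c ℚ.* α p)
small-*-neg {c = c} {α} c<0 (p , α<≡0 , αp<0) = p , (λ q q<p → *-zero c (α<≡0 q q<p)) ,
  ≡.subst (ℚ._< c ℚ.* α p) (ℚ.*-zeroʳ c) (ℚ.*-monoʳ-<-neg c {{ℚ.negative c<0}} αp<0)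

isSmall : Vector ℚ m → Bool
isSmall α = does (small? α)

isSmall⇒small : ∀ (α : Vector ℚ m) → isSmall α ≡ true → Small α
isSmall⇒small α eq with small? α
... | yes s = s

small⇒isSmall : ∀ (α : Vector ℚ m) → Small α → isSmall α ≡ true
small⇒isSmall α = dec-true (small? α)

large⇒¬isSmall : ∀ (α : Vector ℚ m) → Large α → isSmall α ≡ false
large⇒¬isSmall α l = dec-false (small? α) (λ s → small⇒¬large s l)

isSmall-cong : ∀ {α β : Vector ℚ m} → α ≗ β → isSmall α ≡ isSmall β
isSmall-cong {α = α} {β} α≗β with small? α
... | yes s = ≡.sym (dec-true (small? β) (small-cong α≗β s))
... | no ¬s = ≡.sym (dec-false (small? β) (¬s ∘ small-cong (≡.sym ∘ α≗β)))

-- Multiplication of signs, with `true` for plus.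
_same-as_ : Bool → Bool → Bool
true  same-as u = u
false same-as u = not u

isPositive : ℚ → Bool
isPositive c = does (0ℚ ℚ.<? c)

-- The entry `α q` excludes the zero vector, which is neither small nor large. For the remaining
-- vectors not small means large, so a negative `c` negates the Boolean.
isSmall-* : ∀ c (α : Vector ℚ m) q → c ≢ 0ℚ → α q ≢ 0ℚ →
            isSmall (λ p → c ℚ.* α p) ≡ isPositive c same-as isSmall α
isSmall-* c α q c≢0 αq≢0 with ℚ.<-cmp c 0ℚ | small-or-large α q αq≢0
... | tri≈ _ c≡0 _ | _ = contradiction c≡0 c≢0
... | tri> _ _ c>0 | inj₁ s
  rewrite dec-true (0ℚ ℚ.<? c) c>0 | small⇒isSmall α s = small⇒isSmall _ (small-*-pos c>0 s)
... | tri> _ _ c>0 | inj₂ l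
  rewrite dec-true (0ℚ ℚ.<? c) c>0 | large⇒¬isSmall α l = large⇒¬isSmall _ (large-*-pos c>0 l)
... | tri< c<0 _ _ | inj₁ s
  rewrite dec-false (0ℚ ℚ.<? c) (ℚ.<-asym c<0) | small⇒isSmall α s = large⇒¬isSmall _ (large-*-neg c<0 s)
... | tri< c<0 _ _ | inj₂ l
  rewrite dec-false (0ℚ ℚ.<? c) (ℚ.<-asym c<0) | large⇒¬isSmall α l = small⇒isSmall _ (small-*-neg c<0 l)

-- Clearing denominators: rational exponents as integers over N

fromℤ-+ : ∀ a b → fromℤ (a ℤ.+ b) ≡ fromℤ a ℚ.+ fromℤ b
fromℤ-+ a b = ℚ.toℚᵘ-injective (ℚᵘ.≃-trans (*≡* (≡.cong (ℤ._* ℤ.1ℤ)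
  (≡.sym (≡.cong₂ ℤ._+_ (ℤ.*-identityʳ a) (ℤ.*-identityʳ b))))) (ℚᵘ.≃-sym (ℚ.toℚᵘ-homo-+ (fromℤ a) (fromℤ b))))

fromℤ-* : ∀ a b → fromℤ (a ℤ.* b) ≡ fromℤ a ℚ.* fromℤ b
fromℤ-* a b = ℚ.toℚᵘ-injective (ℚᵘ.≃-sym (ℚ.toℚᵘ-homo-* (fromℤ a) (fromℤ b)))

fromℤ-injective : ∀ {a b} → fromℤ a ≡ fromℤ b → a ≡ b
fromℤ-injective = ≡.cong ↥_

module Scale (N : ℕ) .{{_ : ℕ.NonZero N}} where

  scale-fromℤ : ∀ q → ↧ₙ q ℕ.∣ N → fromℤ (scale N q) ≡ fromℤ (+ N) ℚ.* q
  scale-fromℤ q@record{} d∣N = ℚ.toℚᵘ-injective (ℚᵘ.≃-trans (*≡* eq)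
    (ℚᵘ.≃-sym (ℚ.toℚᵘ-homo-* (fromℤ (+ N)) q)))
    where
    open ≡.≡-Reasoning
    d = ↧ₙ q
    eq : scale N q ℤ.* + (1 ℕ.* d) ≡ + N ℤ.* ↥ q ℤ.* + 1
    eq = begin
      ↥ q ℤ.* + (N ℕ./ d) ℤ.* + (1 ℕ.* d)    ≡⟨ ≡.cong (λ z → ↥ q ℤ.* + (N ℕ./ d) ℤ.* + z) (ℕ.*-identityˡ d) ⟩
      ↥ q ℤ.* + (N ℕ./ d) ℤ.* + d            ≡⟨ ℤ.*-assoc (↥ q) _ _ ⟩
      ↥ q ℤ.* (+ (N ℕ./ d) ℤ.* + d)          ≡⟨ ≡.cong (↥ q ℤ.*_) (≡.sym (ℤ.pos-* (N ℕ./ d) d)) ⟩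
      ↥ q ℤ.* + (N ℕ./ d ℕ.* d)              ≡⟨ ≡.cong (λ z → ↥ q ℤ.* + z) (ℕ.m/n*n≡m d∣N) ⟩
      ↥ q ℤ.* + N                            ≡⟨ ℤ.*-comm (↥ q) (+ N) ⟩
      + N ℤ.* ↥ q                            ≡⟨ ℤ.*-identityʳ _ ⟨
      + N ℤ.* ↥ q ℤ.* + 1                    ∎

  scale-pos : ∀ {q} → ↧ₙ q ℕ.∣ N → 0ℚ ℚ.< q → +0 ℤ.< scale N q
  scale-pos {q} d∣N q>0 with positive q (ℚ.positive q>0)
    where
    positive : ∀ q → ℚ.Positive q → ∃[ k ] ↥ q ≡ +[1+ k ]
    positive (mkℚ +[1+ k ] _ _) _ = k , ≡.refl
  ... | k , eq rewrite eq with N ℕ./ ↧ₙ q | ℕ.m≥n⇒m/n>0 {N} {↧ₙ q} (ℕ.∣⇒≤ d∣N)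
  ... | suc j | _ = ℤ.+<+ (ℕ.s≤s ℕ.z≤n)

  scale-neg : ∀ q → scale N (ℚ.- q) ≡ ℤ.- scale N q
  scale-neg q@(mkℚ -[1+ _ ] _ _) = ≡.sym (ℤ.neg-distribˡ-* (↥ q) _)
  scale-neg (mkℚ +0       _ _) = ≡.refl
  scale-neg q@(mkℚ +[1+ _ ] _ _) = ≡.sym (ℤ.neg-distribˡ-* (↥ q) _)

  denominator-neg : ∀ {q} → ↧ₙ q ℕ.∣ N → ↧ₙ (ℚ.- q) ℕ.∣ N
  denominator-neg {q} = ≡.subst (ℕ._∣ N) (≡.sym (ℤ.+-injective (ℚ.↧-neg q)))

  scale-≢0 : ∀ {q} → ↧ₙ q ℕ.∣ N → q ≢ 0ℚ → scale N q ≢ +0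
  scale-≢0 {q} d∣N q≢0 eq with ℚ.<-cmp q 0ℚ
  ... | tri≈ _ q≡0 _ = q≢0 q≡0
  ... | tri> _ _ q>0 = ℤ.<-irrefl (≡.sym eq) (scale-pos d∣N q>0)
  ... | tri< q<0 _ _ = ℤ.<-irrefl (≡.trans (≡.cong ℤ.-_ (≡.sym eq)) (≡.sym (scale-neg q)))
    (scale-pos (denominator-neg {q} d∣N) (ℚ.neg-antimono-< q<0))

  scaled : Vector ℚ m → Vector ℤ m
  scaled α p = scale N (α p)

  scaled-positive : ∀ (α : Vector ℚ m) → (∀ p → ↧ₙ (α p) ℕ.∣ N) → Small α → Positive (scaled α)
  scaled-positive α d∣N (p , α<≡0 , αp>0) =
    p , (λ q q<p → ≡.cong (scale N) (α<≡0 q q<p)) , scale-pos (d∣N p) αp>0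

  module _ {c ℓ} (K : CommutativeRing c ℓ) where
    open Expansions K N
    open Series (CommutativeRing.rawRing K) N

    sparse-1/[1-x] : ∀ (α : Vector ℚ m) q → (∀ p → ↧ₙ (α p) ℕ.∣ N) → α q ≢ 0ℚ →
                     Sparse m 1/[1-x^ α ] (_· scaled α) (χ (isSmall α))
    sparse-1/[1-x] α q d∣N αq≢0 with small? α | large? α
    ... | yes s | _ = sparse-small (scaled α) q (scale-≢0 (d∣N q) αq≢0) (scaled-positive α d∣N s)
    ... | no ¬s | no ¬l = contradiction (small-or-large α q αq≢0) λ { (inj₁ s) → ¬s s ; (inj₂ l) → ¬l l }
    ... | no _  | yes (p , α<≡0 , αp<0) =
      sparse-large (scaled α) (scaled -α) q
        (λ eq → scale-≢0 (d∣N q) αq≢0 (ℤ.neg-injective (≡.trans (≡.sym (scale-neg (α q))) eq)))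
        (λ p → scale-neg (α p))
        (scaled-positive -α (λ p → denominator-neg {α p} (d∣N p))
          (p , (λ q q<p → ≡.cong ℚ.-_ (α<≡0 q q<p)) , ℚ.neg-antimono-< αp<0))
      where
      -α = λ p → ℚ.- α p

-- Pivoting

nonZero⇒≢0 : ∀ q .{{_ : NonZero q}} → q ≢ 0ℚ
nonZero⇒≢0 q@record{} q≡0 = ℕ.≢-nonZero⁻¹ ℤ.∣ ↥ q ∣ (≡.cong (ℤ.∣_∣ ∘ ↥_) q≡0)

-- Made total, with value 0 at 0, so that the vectors `v s` can be formed for all columns without
-- carrying a proof that `b s` is nonzero.
recip : ℚ → ℚ
recip q = branch (¬? (q ℚ.≟ 0ℚ)) (λ q≢0 → ℚ.1/_ q {{≢-nonZero q≢0}}) 0ℚ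

recip-inverse : ∀ q → q ≢ 0ℚ → q ℚ.* recip q ≡ 1ℚ
recip-inverse q q≢0 = branch-elim (λ z → q ℚ.* z ≡ 1ℚ) (¬? (q ℚ.≟ 0ℚ))
  (λ q≢0 → ℚ.*-inverseʳ q {{≢-nonZero q≢0}}) (contradiction q≢0)

1/≡recip : ∀ q .{{_ : NonZero q}} → ℚ.1/ q ≡ recip q
1/≡recip q = branch-elim (ℚ.1/ q ≡_) (¬? (q ℚ.≟ 0ℚ))
  (λ _ → ≡.refl) (contradiction (λ q≡0 → nonZero⇒≢0 q q≡0))

module _ {J : Subset n} {j s : Fin n} where

  ∉∪⇒∉ : s ∉ J ∪ ⁅ j ⁆ → s ∉ J
  ∉∪⇒∉ s∉ s∈J = s∉ (p⊆p∪q ⁅ j ⁆ s∈J)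

  ∉∪⇒≢ : s ∉ J ∪ ⁅ j ⁆ → s ≢ j
  ∉∪⇒≢ s∉ ≡.refl = s∉ (q⊆p∪q J ⁅ j ⁆ (x∈⁅x⁆ j))

  ∉∪ : s ∉ J → s ≢ j → s ∉ J ∪ ⁅ j ⁆
  ∉∪ s∉J s≢j s∈ = [ s∉J , (λ s∈j → s≢j (x∈⁅y⁆⇒x≡y j s∈j)) ]′ (x∈p∪q⁻ J ⁅ j ⁆ s∈)

col-injective : ∀ {s j : Fin n} → col s ≡ col j → s ≡ j
col-injective {s = s} {j} = Fin.↑ˡ-injective 1 s j

lastCol≢col : ∀ (j : Fin n) → lastCol ≢ col j
lastCol≢col {n} j eq with ≡.trans (≡.sym (Fin.splitAt-↑ʳ n 1 zero)) (≡.trans (≡.cong (splitAt n) eq) (Fin.splitAt-↑ˡ n j 1))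
... | ()

pivot-entry : ∀ (O : Matrix n r) i j .{{_ : NonZero (O (λRow i) (col j))}} p s → s ≢ col j →
              pivot O i j p s ≡ O p s ℚ.- (O (λRow i) s ℚ.* recip (O (λRow i) (col j))) ℚ.* O p (col j)
pivot-entry O i j p s s≢ = branch-elim
  (_≡ O p s ℚ.- (O (λRow i) s ℚ.* recip (O (λRow i) (col j))) ℚ.* O p (col j))
  (s Fin.≟ col j) (λ eq → contradiction eq s≢)
  (λ _ → ≡.cong (λ z → O p s ℚ.- (O (λRow i) s ℚ.* z) ℚ.* O p (col j)) (1/≡recip (O (λRow i) (col j))))

-- The rows y_j of the columns not yet used as pivot columns are still those of (id | 0).
record Reduced (O : Matrix n r) (J : Subset n) : Set where
  field
    diagonal : ∀ j → j ∉ J → O (yRow j) (col j) ≡ 1ℚ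
    row-zero : ∀ j → j ∉ J → ∀ s → s ≢ col j → (∀ l → l ∈ J → s ≢ col l) → O (yRow j) s ≡ 0ℚ

  off-diagonal : ∀ s j → s ∉ J → j ∉ J → s ≢ j → O (yRow j) (col s) ≡ 0ℚ
  off-diagonal s j s∉J j∉J s≢j = row-zero j j∉J (col s) (s≢j ∘ col-injective)
    (λ l l∈J eq → s∉J (≡.subst (_∈ J) (≡.sym (col-injective eq)) l∈J))

  last-zero : ∀ j → j ∉ J → O (yRow j) lastCol ≡ 0ℚ
  last-zero j j∉J = row-zero j j∉J lastCol (lastCol≢col j) (λ l _ → lastCol≢col l)

private
  minus-zero : ∀ {a b} c → a ≡ b → a ℚ.- c ℚ.* 0ℚ ≡ b
  minus-zero {a} c a≡b = ≡.trans (≡.cong (λ z → a ℚ.- z) (ℚ.*-zeroʳ c)) (≡.trans (ℚ.+-identityʳ a) a≡b)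

reduced : ∀ {A b k I J} {O : Matrix n r} → Pivots (initial A b) k I J O → Reduced O J
reduced {n} {r} {A} {b} none = record { diagonal = λ j _ → diag j ; row-zero = λ j _ s s≢ _ → zeros j s s≢ }
  where
  diag : ∀ j → initial A b (yRow j) (col j) ≡ 1ℚ
  diag j rewrite Fin.splitAt-↑ˡ n j r | Fin.splitAt-↑ˡ n j 1 =
    branch-elim (_≡ 1ℚ) (j Fin.≟ j) (λ _ → ≡.refl) (contradiction ≡.refl)
  zeros : ∀ j s → s ≢ col j → initial A b (yRow j) s ≡ 0ℚ
  zeros j s s≢ rewrite Fin.splitAt-↑ˡ n j r with splitAt n s in eq
  ... | inj₂ _ = ≡.refl
  ... | inj₁ l = branch-elim (_≡ 0ℚ) (j Fin.≟ l)
    (λ { ≡.refl → contradiction (≡.sym (Fin.splitAt⁻¹-↑ˡ {m = n} {n = 1} {i = s} eq)) s≢ }) (λ _ → ≡.refl)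
reduced (step {J = J} {O} pivots i j i∉I j∉J) = record { diagonal = diag ; row-zero = zeros }
  where
  open Reduced (reduced pivots)
  multiple-zero : ∀ l → l ∉ J ∪ ⁅ j ⁆ → ∀ s → s ≢ col j → ∀ {v} → O (yRow l) s ≡ v → pivot O i j (yRow l) s ≡ v
  multiple-zero l l∉ s s≢ eq = ≡.trans (pivot-entry O i j (yRow l) s s≢)
    (≡.trans (≡.cong (λ z → O (yRow l) s ℚ.- c ℚ.* z)
               (off-diagonal j l j∉J (∉∪⇒∉ l∉) (∉∪⇒≢ l∉ ∘ ≡.sym)))
             (minus-zero c eq))
    where c = O (λRow i) s ℚ.* recip (O (λRow i) (col j))
  diag : ∀ l → l ∉ J ∪ ⁅ j ⁆ → pivot O i j (yRow l) (col l) ≡ 1ℚ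
  diag l l∉ = multiple-zero l l∉ (col l) (∉∪⇒≢ l∉ ∘ col-injective) (diagonal l (∉∪⇒∉ l∉))
  zeros : ∀ l → l ∉ J ∪ ⁅ j ⁆ → ∀ s → s ≢ col l → (∀ k → k ∈ J ∪ ⁅ j ⁆ → s ≢ col k) → pivot O i j (yRow l) s ≡ 0ℚ
  zeros l l∉ s s≢ others = multiple-zero l l∉ s (others j (q⊆p∪q J ⁅ j ⁆ (x∈⁅x⁆ j)))
    (row-zero l (∉∪⇒∉ l∉) s s≢ (λ k k∈J → others k (p⊆p∪q ⁅ j ⁆ k∈J)))

exponents-yRow : ∀ (O : Matrix n r) I s j → exponents O I s (yRow j) ≡ O (yRow j) s
exponents-yRow {n} {r} O I s j rewrite Fin.splitAt-↑ˡ n j r = ≡.refl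

exponents-λRow : ∀ (O : Matrix n r) I s i → i ∉ I → exponents O I s (λRow i) ≡ O (λRow i) s
exponents-λRow {n} {r} O I s i i∉I rewrite Fin.splitAt-↑ʳ n r i =
  branch-elim (_≡ O (λRow i) s) (i ∈? I) (λ i∈I → contradiction i∈I i∉I) (λ _ → ≡.refl)

exponents-denominators : ∀ {N} (O : Matrix n r) I → DenominatorsDivide N O →
                         ∀ s p → ↧ₙ (exponents O I s p) ℕ.∣ N
exponents-denominators {n} {N = N} O I d∣N s p with splitAt n p
... | inj₁ _ = d∣N p s
... | inj₂ i = branch-elim (λ q → ↧ₙ q ℕ.∣ N) (i ∈? I) (λ _ → ℕ.1∣ N) (λ _ → d∣N p s)

-- Ignoring row `i` after the pivot agrees with the elimination formula: there it reads x - (x / b)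
-- b = 0, which is the exponent given to an omitted row. In the rows already omitted all terms are
-- zero.
exponents-pivot : ∀ (O : Matrix n r) I i j .{{_ : NonZero (O (λRow i) (col j))}} → i ∉ I →
                  ∀ s p → s ≢ col j →
                  exponents (pivot O i j) (I ∪ ⁅ i ⁆) s p ≡
                  exponents O I s p ℚ.- (O (λRow i) s ℚ.* recip (O (λRow i) (col j))) ℚ.* exponents O I (col j) p
exponents-pivot {n} {r} O I i j {{b≢0}} i∉I s p s≢ with splitAt n p in eq
... | inj₁ _ = pivot-entry O i j p s s≢
... | inj₂ i′ with i′ ∈? I | i′ ∈? (I ∪ ⁅ i ⁆)
...   | yes _   | yes _ = ≡.sym (minus-zero {0ℚ} (O (λRow i) s ℚ.* recip (O (λRow i) (col j))) ≡.refl)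
...   | yes ∈I  | no ∉∪I = contradiction (p⊆p∪q ⁅ i ⁆ ∈I) ∉∪I
...   | no _    | no _ = pivot-entry O i j p s s≢
...   | no i′∉I | yes i′∈ with x∈⁅y⁆⇒x≡y i ([ (λ i′∈I → contradiction i′∈I i′∉I) , id ]′ (x∈p∪q⁻ I ⁅ i ⁆ i′∈))
...     | ≡.refl with Fin.splitAt⁻¹-↑ʳ {m = n} {n = r} {i = p} eq
...       | ≡.refl = ≡.sym (≡.trans (solve 3 (λ a β b → a :- a :* β :* b := a :- a :* (b :* β)) ≡.refl x (recip y) y)
                       (≡.trans (≡.cong (λ z → x ℚ.- x ℚ.* z) (recip-inverse y (nonZero⇒≢0 y)))
                                (≡.trans (≡.cong (λ z → x ℚ.- z) (ℚ.*-identityʳ x)) (ℚ.+-inverseʳ x))))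
  where
  open +-*-Solver
  x = O (λRow i) s
  y = O (λRow i) (col j)

∑ℚ : Vector ℚ n → ℚ
∑ℚ = RawMonoidSum.sum ℚ.+-0-rawMonoid

∑ℚ-cong : ∀ {n} {F G : Vector ℚ n} → (∀ s → F s ≡ G s) → ∑ℚ F ≡ ∑ℚ G
∑ℚ-cong {zero}  F≡G = ≡.refl
∑ℚ-cong {suc n} F≡G = ≡.cong₂ ℚ._+_ (F≡G zero) (∑ℚ-cong (F≡G ∘ suc))

∑ℚ-linear : ∀ {n} c {F G H : Vector ℚ n} → (∀ s → H s ≡ F s ℚ.- G s ℚ.* c) → ∑ℚ H ≡ ∑ℚ F ℚ.- ∑ℚ G ℚ.* c
∑ℚ-linear {zero}  c H≡ = ≡.sym (≡.trans (≡.cong (λ z → 0ℚ ℚ.- z) (ℚ.*-zeroˡ c)) (ℚ.+-identityʳ 0ℚ))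
∑ℚ-linear {suc n} c {F} {G} H≡ = ≡.trans (≡.cong₂ ℚ._+_ (H≡ zero) (∑ℚ-linear c (H≡ ∘ suc)))
  (solve 5 (λ f g c x y → f :- g :* c :+ (x :- y :* c) := f :+ x :- (g :+ y) :* c) ≡.refl
    (F zero) (G zero) c (∑ℚ (tail F)) (∑ℚ (tail G)))
  where open +-*-Solver

∑ℚ-split : ∀ {n} (F G : Vector ℚ n) j → G j ≡ 0ℚ → (∀ s → s ≢ j → G s ≡ F s) → ∑ℚ F ≡ F j ℚ.+ ∑ℚ G
∑ℚ-split F G zero    Gj≡0 G≡F = ≡.cong (F zero ℚ.+_)
  (≡.trans (∑ℚ-cong (λ s → ≡.sym (G≡F (suc s) λ ()))) (≡.trans (≡.sym (ℚ.+-identityˡ _)) (≡.cong (ℚ._+ ∑ℚ (tail G)) (≡.sym Gj≡0))))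
∑ℚ-split F G (suc j) Gj≡0 G≡F = ≡.trans
  (≡.cong₂ ℚ._+_ (≡.sym (G≡F zero λ ())) (∑ℚ-split (tail F) (tail G) j Gj≡0 (λ s s≢ → G≡F (suc s) (s≢ ∘ Fin.suc-injective))))
  (solve 3 (λ a b c → a :+ (b :+ c) := b :+ (a :+ c)) ≡.refl (G zero) (F (suc j)) (∑ℚ (tail G)))
  where open +-*-Solver

∑ℚ-zero : ∀ {n} {F : Vector ℚ n} → (∀ s → F s ≡ 0ℚ) → ∑ℚ F ≡ 0ℚ
∑ℚ-zero {zero}  F≡0 = ≡.refl
∑ℚ-zero {suc n} F≡0 = ≡.cong₂ ℚ._+_ (F≡0 zero) (∑ℚ-zero (F≡0 ∘ suc))

∑∉ : Subset n → Vector ℚ n → ℚ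
∑∉ J F = foldOver ℚ.+-0-rawMonoid (λ s → ¬? (s ∈? J)) (λ s _ → F s)

module _ (J : Subset n) where

  ∑∉-cong : ∀ {F G} → (∀ s → s ∉ J → F s ≡ G s) → ∑∉ J F ≡ ∑∉ J G
  ∑∉-cong {F} {G} F≡G = ∑ℚ-cong λ s → summand s
    where
    summand : ∀ s → branch (¬? (s ∈? J)) (λ _ → F s) 0ℚ ≡ branch (¬? (s ∈? J)) (λ _ → G s) 0ℚ
    summand s with s ∈? J
    ... | yes _ = ≡.refl
    ... | no s∉ = F≡G s s∉

  ∑∉-linear : ∀ c {F G H} → (∀ s → s ∉ J → H s ≡ F s ℚ.- G s ℚ.* c) → ∑∉ J H ≡ ∑∉ J F ℚ.- ∑∉ J G ℚ.* c
  ∑∉-linear c {F} {G} {H} H≡ = ∑ℚ-linear c summand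
    where
    summand : ∀ s → branch (¬? (s ∈? J)) (λ _ → H s) 0ℚ ≡
              branch (¬? (s ∈? J)) (λ _ → F s) 0ℚ ℚ.- branch (¬? (s ∈? J)) (λ _ → G s) 0ℚ ℚ.* c
    summand s with s ∈? J
    ... | yes _ = ≡.sym (≡.trans (≡.cong (λ z → 0ℚ ℚ.- z) (ℚ.*-zeroˡ c)) (ℚ.+-identityʳ 0ℚ))
    ... | no s∉ = H≡ s s∉

  ∑∉-zero : ∀ {F} → (∀ s → s ∉ J → F s ≡ 0ℚ) → ∑∉ J F ≡ 0ℚ
  ∑∉-zero F≡0 = ∑ℚ-zero λ s → branch-elim (_≡ 0ℚ) (¬? (s ∈? J)) (F≡0 s) (λ _ → ≡.refl)

  ∑∉-split : ∀ F j → j ∉ J → ∑∉ J F ≡ F j ℚ.+ ∑∉ (J ∪ ⁅ j ⁆) F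
  ∑∉-split F j j∉J = ≡.trans (∑ℚ-split _ _ j
      (branch-elim (_≡ 0ℚ) (¬? (j ∈? (J ∪ ⁅ j ⁆))) (λ j∉ → contradiction ≡.refl (∉∪⇒≢ {J = J} j∉)) (λ _ → ≡.refl))
      same)
    (≡.cong (ℚ._+ ∑∉ (J ∪ ⁅ j ⁆) F) (branch-elim (_≡ F j) (¬? (j ∈? J)) (λ _ → ≡.refl) (contradiction j∉J)))
    where
    same : ∀ s → s ≢ j → branch (¬? (s ∈? (J ∪ ⁅ j ⁆))) (λ _ → F s) 0ℚ ≡ branch (¬? (s ∈? J)) (λ _ → F s) 0ℚ
    same s s≢ with s ∈? J | s ∈? (J ∪ ⁅ j ⁆)
    ... | yes _   | yes _ = ≡.refl
    ... | no _    | no _  = ≡.refl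
    ... | yes s∈J | no s∉ = contradiction (p⊆p∪q ⁅ j ⁆ s∈J) s∉
    ... | no s∉J  | yes s∈ = contradiction s∈ (∉∪ s∉J s≢)

-- The exponent vector of the term of the bracket in which the factor of column s contributes its
-- t s-th power.
exponentAt : Matrix n r → Subset r → Subset n → Vector ℤ n → Vector ℚ (n ℕ.+ r)
exponentAt O I J t p = exponents O I lastCol p ℚ.+ ∑∉ J (λ s → fromℤ (t s) ℚ.* exponents O I (col s) p)

-- The coefficients of a bracket

module _ (N : ℕ) .{{_ : ℕ.NonZero N}} where
  open Scale N

  -- e / N is the exponent vector α.
  _At_ : ∀ {m} → Vector ℤ m → Vector ℚ m → Set
  e At α = ∀ p → fromℤ (e p) ≡ fromℤ (+ N) ℚ.* α p

  module _ {c ℓ} (K : CommutativeRing c ℓ) {n r : ℕ} where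
    open CommutativeRing K using (_≈_; 0#; *-rawMonoid)
    open Expansions K N
    open Brackets (CommutativeRing.rawRing K) N {n} {r} using (bracket)
    open Series (CommutativeRing.rawRing K) N using (1/[1-x^_])

    module _ (O : Matrix n r) (I : Subset r) (J : Subset n)
             (red : Reduced O J) (d∣N : DenominatorsDivide N O) where

      weight : Vector ℤ n → CommutativeRing.Carrier K
      weight t = foldOver *-rawMonoid (λ j → ¬? (j ∈? J))
                   (λ j _ → χ (isSmall (exponents O I (col j))) (t j))

      private
        open Reduced red

        α : Fin n → Vector ℤ (n ℕ.+ r)
        α j p = branch (¬? (j ∈? J)) (λ _ → scale N (exponents O I (col j) p)) +0

        α-∉ : ∀ j → j ∉ J → ∀ p → α j p ≡ scale N (exponents O I (col j) p)
        α-∉ j j∉J p = branch-elim (_≡ _) (¬? (j ∈? J)) (λ _ → ≡.refl) (contradiction j∉J)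

        α-∈ : ∀ j → ¬ j ∉ J → ∀ p → α j p ≡ +0
        α-∈ j j∈J p = branch-elim (_≡ +0) (¬? (j ∈? J)) (λ j∉J → contradiction j∉J j∈J) (λ _ → ≡.refl)

        γ-diagonal : ∀ j → j ∉ J → exponents O I (col j) (yRow j) ≢ 0ℚ
        γ-diagonal j j∉J eq = ℚ.1≢0 (≡.trans (≡.sym (diagonal j j∉J)) (≡.trans (≡.sym (exponents-yRow O I (col j) j)) eq))

        dens = exponents-denominators O I d∣N

        off : ∀ i j → j ∉ J → i ≢ j → α i (yRow j) ≡ +0
        off i j j∉J i≢j = branch-elim (_≡ +0) (¬? (i ∈? J))
          (λ i∉J → ≡.cong (scale N) (≡.trans (exponents-yRow O I (col i) j) (off-diagonal i j i∉J j∉J i≢j)))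
          (λ _ → ≡.refl)

        point : Vector ℤ n → Vector ℤ (n ℕ.+ r)
        point t p = scale N (exponents O I lastCol p) ℤ.+ ∑ℤ (λ j → t j ℤ.* α j p)

        sparse : Sparse (n ℕ.+ r) (bracket O I J) point weight
        sparse = sparse-shift (scaled (exponents O I lastCol))
          (sparse-product (λ j → ¬? (j ∈? J)) (λ j _ → 1/[1-x^ exponents O I (col j) ]) α yRow
            (λ j → isSmall (exponents O I (col j)))
            (λ j j∉J → reindex (sparse-1/[1-x] K (exponents O I (col j)) (yRow j) (dens (col j)) (γ-diagonal j j∉J))
              id id (λ t p → ≡.cong (t ℤ.*_) (α-∉ j j∉J p)) (λ t p → ≡.cong (t ℤ.*_) (≡.sym (α-∉ j j∉J p)))
              (λ _ → CommutativeRing.refl K))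
            (λ j j∉J eq → scale-≢0 (dens (col j) (yRow j)) (γ-diagonal j j∉J) (≡.trans (≡.sym (α-∉ j j∉J (yRow j))) eq))
            off α-∈)

        fromℤ-∑ : ∀ {n} (F : Vector ℤ n) (G : Vector ℚ n) → (∀ s → fromℤ (F s) ≡ fromℤ (+ N) ℚ.* G s) →
                  fromℤ (∑ℤ F) ≡ fromℤ (+ N) ℚ.* ∑ℚ G
        fromℤ-∑ {zero}  F G F≡ = ≡.sym (ℚ.*-zeroʳ (fromℤ (+ N)))
        fromℤ-∑ {suc n} F G F≡ = ≡.trans (fromℤ-+ (F zero) _)
          (≡.trans (≡.cong₂ ℚ._+_ (F≡ zero) (fromℤ-∑ (tail F) (tail G) (F≡ ∘ suc)))
                   (≡.sym (ℚ.*-distribˡ-+ (fromℤ (+ N)) (G zero) (∑ℚ (tail G)))))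

        point-At : ∀ t → point t At exponentAt O I J t
        point-At t p = ≡.trans (fromℤ-+ (scale N (exponents O I lastCol p)) (∑ℤ λ j → t j ℤ.* α j p))
          (≡.trans (≡.cong₂ ℚ._+_ (scale-fromℤ (exponents O I lastCol p) (dens lastCol p)) (fromℤ-∑ _ summands summand))
                   (≡.sym (ℚ.*-distribˡ-+ (fromℤ (+ N)) (exponents O I lastCol p) (∑ℚ summands))))
          where
          open +-*-Solver
          summands : Vector ℚ n
          summands j = branch (¬? (j ∈? J)) (λ _ → fromℤ (t j) ℚ.* exponents O I (col j) p) 0ℚ
          summand : ∀ j → fromℤ (t j ℤ.* α j p) ≡ fromℤ (+ N) ℚ.* summands j
          summand j with j ∈? J
          ... | yes _ = ≡.trans (≡.cong fromℤ (ℤ.*-zeroʳ (t j))) (≡.sym (ℚ.*-zeroʳ (fromℤ (+ N))))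
          ... | no _  = ≡.trans (fromℤ-* (t j) _) (≡.trans
            (≡.cong (fromℤ (t j) ℚ.*_) (scale-fromℤ (exponents O I (col j) p) (dens (col j) p)))
            (solve 3 (λ a b c → a :* (b :* c) := b :* (a :* c)) ≡.refl
              (fromℤ (t j)) (fromℤ (+ N)) (exponents O I (col j) p)))

        at⇒point : ∀ {e t} → e At exponentAt O I J t → e ≗ point t
        at⇒point {e} {t} eAt p = fromℤ-injective (≡.trans (eAt p) (≡.sym (point-At t p)))

        point⇒at : ∀ {e t} → e ≗ point t → e At exponentAt O I J t
        point⇒at {e} {t} e≗ p = ≡.trans (≡.cong fromℤ (e≗ p)) (point-At t p)

      coef-bracket : ∀ t e → e At exponentAt O I J t → coef (n ℕ.+ r) (bracket O I J) e ≈ weight t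
      coef-bracket t e eAt = hit sparse t e (at⇒point eAt)

      coef-bracket-0 : ∀ e → (∀ t → ¬ e At exponentAt O I J t) → coef (n ℕ.+ r) (bracket O I J) e ≈ 0#
      coef-bracket-0 e nowhere = miss sparse e (λ t e≗ → nowhere t (point⇒at e≗))

      bracket-At? : ∀ e → Dec (∃[ t ] e At exponentAt O I J t)
      bracket-At? e = Dec.map′ (λ { (t , e≗) → t , point⇒at e≗ }) (λ { (t , eAt) → t , at⇒point eAt })
                        (found? sparse e)

-- The order of the columns and the effect of a pivot

does⇒ : ∀ {a} {A : Set a} (d : Dec A) → does d ≡ true → A
does⇒ (yes a) _ = a

recip-≢0 : ∀ q → q ≢ 0ℚ → recip q ≢ 0ℚ
recip-≢0 q q≢0 eq = ℚ.1≢0 (≡.trans (≡.sym (recip-inverse q q≢0)) (≡.trans (≡.cong (q ℚ.*_) eq) (ℚ.*-zeroʳ q)))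

*-cancel-ℚ : ∀ q {a b} → q ≢ 0ℚ → q ℚ.* a ≡ q ℚ.* b → a ≡ b
*-cancel-ℚ q {a} {b} q≢0 eq = ≡.trans (undo a) (≡.trans (≡.cong (recip q ℚ.*_) eq) (≡.sym (undo b)))
  where
  open +-*-Solver
  undo : ∀ a → a ≡ recip q ℚ.* (q ℚ.* a)
  undo a = ≡.trans (≡.sym (ℚ.*-identityˡ a)) (≡.trans (≡.cong (ℚ._* a) (≡.sym (recip-inverse q q≢0)))
    (solve 3 (λ q β a → q :* β :* a := β :* (q :* a)) ≡.refl q (recip q) a))

module Geometry {n r : ℕ} (O : Matrix n r) (I : Subset r) (J : Subset n) (red : Reduced O J)
                (i : Fin r) (i∉I : i ∉ I) where
  open Reduced red

  b : Fin n → ℚ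
  b s = O (λRow i) (col s)

  γ : Fin n → Vector ℚ (n ℕ.+ r)
  γ s = exponents O I (col s)

  γ₀ : Vector ℚ (n ℕ.+ r)
  γ₀ = exponents O I lastCol

  γ-diagonal : ∀ s → s ∉ J → γ s (yRow s) ≡ 1ℚ
  γ-diagonal s s∉J = ≡.trans (exponents-yRow O I (col s) s) (diagonal s s∉J)

  γ-off-diagonal : ∀ s j → s ∉ J → j ∉ J → s ≢ j → γ s (yRow j) ≡ 0ℚ
  γ-off-diagonal s j s∉J j∉J s≢j = ≡.trans (exponents-yRow O I (col s) j) (off-diagonal s j s∉J j∉J s≢j)

  γ-pivotRow : ∀ s → γ s (λRow i) ≡ b s
  γ-pivotRow s = exponents-λRow O I (col s) i i∉I

  -- The columns γ s with b s ≢ 0 are ordered by comparing γ s / b s lexicographically; a column is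
  -- contributing when it lies above the zero vector.
  v : Fin n → Vector ℚ (n ℕ.+ r)
  v s p = recip (b s) ℚ.* γ s p

  Active : Fin n → Set
  Active s = s ∉ J × b s ≢ 0ℚ

  active? : ∀ s → Dec (Active s)
  active? s = ¬? (s ∈? J) ×-dec ¬? (b s ℚ.≟ 0ℚ)

  active : Fin n → Bool
  active s = does (active? s)

  Active⇒active : ∀ {s} → Active s → active s ≡ true
  Active⇒active {s} = dec-true (active? s)

  active⇒Active : ∀ {s} → active s ≡ true → Active s
  active⇒Active {s} = does⇒ (active? s)

  above : Fin n → Fin n → Bool
  above j s = isSmall (λ p → v s p ℚ.- v j p)

  aboveZero : Fin n → Bool
  aboveZero s = isSmall (v s)

  v-diagonal : ∀ {s} → Active s → v s (yRow s) ≢ 0ℚ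
  v-diagonal {s} (s∉J , bs≢0) eq = recip-≢0 (b s) bs≢0
    (≡.trans (≡.sym (≡.trans (≡.cong (recip (b s) ℚ.*_) (γ-diagonal s s∉J)) (ℚ.*-identityʳ _))) eq)

  -- In row y_s the vector `v s` has the nonzero entry 1 / b_s while `v j` has 0. This is why no two
  -- columns tie in the order.
  difference-≢0 : ∀ {j s} → Active s → j ∉ J → s ≢ j → v s (yRow s) ℚ.- v j (yRow s) ≢ 0ℚ
  difference-≢0 {j} {s} as j∉J s≢j eq = v-diagonal as (≡.trans (≡.sym (ℚ.+-identityʳ _))
    (≡.trans (≡.cong (λ z → v s (yRow s) ℚ.- z) (≡.sym vj≡0)) eq))
    where
    vj≡0 : v j (yRow s) ≡ 0ℚ
    vj≡0 = ≡.trans (≡.cong (recip (b j) ℚ.*_) (γ-off-diagonal j s j∉J (proj₁ as) (s≢j ∘ ≡.sym))) (ℚ.*-zeroʳ (recip (b j)))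

  γ≡b*v : ∀ {s} → b s ≢ 0ℚ → ∀ p → γ s p ≡ b s ℚ.* v s p
  γ≡b*v {s} bs≢0 p = ≡.trans (≡.sym (ℚ.*-identityˡ _)) (≡.trans (≡.cong (ℚ._* γ s p) (≡.sym (recip-inverse (b s) bs≢0)))
    (ℚ.*-assoc (b s) (recip (b s)) (γ s p)))

  isSmall-γ : ∀ {s} → Active s → isSmall (γ s) ≡ isPositive (b s) same-as aboveZero s
  isSmall-γ {s} as = ≡.trans (isSmall-cong (γ≡b*v (proj₂ as)))
    (isSmall-* (b s) (v s) (yRow s) (proj₂ as) (v-diagonal as))

  -- Since b_s γ_s is b_s squared times v_s, the sign of b_s cancels. So contributing columns are
  -- those above zero and dually contributing ones those below.
  isSmall-bγ : ∀ {s} → Active s → isSmall (λ p → b s ℚ.* γ s p) ≡ aboveZero s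
  isSmall-bγ {s} as@(s∉J , bs≢0) = ≡.trans (isSmall-* (b s) (γ s) (yRow s) bs≢0
      (λ eq → ℚ.1≢0 (≡.trans (≡.sym (γ-diagonal s s∉J)) eq)))
    (≡.trans (≡.cong (isPositive (b s) same-as_) (isSmall-γ as)) (twice (isPositive (b s)) (aboveZero s)))
    where
    twice : ∀ u w → u same-as (u same-as w) ≡ w
    twice true  w     = ≡.refl
    twice false true  = ≡.refl
    twice false false = ≡.refl

  line : Line active above
  line = record { asymmetric = asymmetric ; transitive = transitive }
    where
    open +-*-Solver
    asymmetric : ∀ j s → active j ≡ true → active s ≡ true → j ≢ s → above s j ≡ not (above j s)
    asymmetric j s aj as j≢s = ≡.trans
      (isSmall-cong λ p → solve 2 (λ x y → x :- y := con (ℚ.- 1ℚ) :* (y :- x)) ≡.refl (v j p) (v s p))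
      (isSmall-* (ℚ.- 1ℚ) (λ p → v s p ℚ.- v j p) (yRow s) (λ ())
        (difference-≢0 (active⇒Active as) (proj₁ (active⇒Active aj)) (j≢s ∘ ≡.sym)))
    transitive : ∀ j k l → active j ≡ true → active k ≡ true → active l ≡ true →
                 above j k ≡ true → above k l ≡ true → above j l ≡ true
    transitive j k l _ _ _ jk kl = small⇒isSmall _ (small-cong
      (λ p → solve 3 (λ x y z → y :- x :+ (z :- y) := z :- x) ≡.refl (v j p) (v k p) (v l p))
      (small-+ (isSmall⇒small _ jk) (isSmall⇒small _ kl)))

  aboveZero-up : UpClosed active above aboveZero
  aboveZero-up j s _ _ js j0 = small⇒isSmall _ (small-cong
    (λ p → solve 2 (λ x y → y :- x :+ x := y) ≡.refl (v j p) (v s p))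
    (small-+ (isSmall⇒small _ js) (isSmall⇒small _ j0)))
    where open +-*-Solver

  module AfterPivot {j} (aj : Active j) where
    private
      instance
        bj≢0 : NonZero (O (λRow i) (col j))
        bj≢0 = ≢-nonZero (proj₂ aj)
      j∉J = proj₁ aj
      open +-*-Solver

    O′ : Matrix n r
    O′ = pivot O i j

    I′ = I ∪ ⁅ i ⁆
    J′ = J ∪ ⁅ j ⁆

    γ′ : ∀ s → s ≢ col j → ∀ p → exponents O′ I′ s p ≡
         exponents O I s p ℚ.- (O (λRow i) s ℚ.* recip (b j)) ℚ.* γ j p
    γ′ s s≢ p = exponents-pivot O I i j i∉I s p s≢

    isSmall-γ′ : ∀ {s} → Active s → s ≢ j →
                 isSmall (exponents O′ I′ (col s)) ≡ isPositive (b s) same-as above j s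
    isSmall-γ′ {s} as s≢j = ≡.trans
      (isSmall-cong λ p → ≡.trans (γ′ (col s) (s≢j ∘ col-injective) p)
        (≡.trans (≡.cong (λ z → z ℚ.- (b s ℚ.* recip (b j)) ℚ.* γ j p) (γ≡b*v (proj₂ as) p))
          (solve 4 (λ b v β γ → b :* v :- b :* β :* γ := b :* (v :- β :* γ)) ≡.refl (b s) (v s p) (recip (b j)) (γ j p))))
      (isSmall-* (b s) (λ p → v s p ℚ.- v j p) (yRow s) (proj₂ as) (difference-≢0 as j∉J s≢j))

    isSmall-γ′-inactive : ∀ {s} → b s ≡ 0ℚ → s ≢ j → isSmall (exponents O′ I′ (col s)) ≡ isSmall (γ s)
    isSmall-γ′-inactive {s} bs≡0 s≢j = isSmall-cong λ p → ≡.trans (γ′ (col s) (s≢j ∘ col-injective) p)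
      (≡.trans (≡.cong (λ z → γ s p ℚ.- (z ℚ.* recip (b j)) ℚ.* γ j p) bs≡0)
        (solve 3 (λ g β h → g :- con 0ℚ :* β :* h := g) ≡.refl (γ s p) (recip (b j)) (γ j p)))

    private
      -- The exponent vector without the share of column `j`. It does not depend on `t j`, and the
      -- exponent vectors before and after the pivot are both expressed through it.
      rest : Vector ℤ n → Vector ℚ (n ℕ.+ r)
      rest t p = γ₀ p ℚ.+ ∑∉ J′ (λ s → fromℤ (t s) ℚ.* γ s p)

      exponentAt-rest : ∀ t p → exponentAt O I J t p ≡ rest t p ℚ.+ fromℤ (t j) ℚ.* γ j p
      exponentAt-rest t p = ≡.trans (≡.cong (γ₀ p ℚ.+_) (∑∉-split J (λ s → fromℤ (t s) ℚ.* γ s p) j j∉J))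
        (solve 3 (λ a b c → a :+ (b :+ c) := a :+ c :+ b) ≡.refl (γ₀ p) (fromℤ (t j) ℚ.* γ j p)
          (∑∉ J′ (λ s → fromℤ (t s) ℚ.* γ s p)))

      rest-pivotRow : ∀ t → rest t (λRow i) ≡ O (λRow i) lastCol ℚ.+ ∑∉ J′ (λ s → fromℤ (t s) ℚ.* b s)
      rest-pivotRow t = ≡.cong₂ ℚ._+_ (exponents-λRow O I lastCol i i∉I)
        (∑∉-cong J′ λ s _ → ≡.cong (fromℤ (t s) ℚ.*_) (γ-pivotRow s))

      -- The pivot projects along γ_j onto the hyperplane where the exponent of λ_i vanishes.
      exponentAt′-rest : ∀ t p → exponentAt O′ I′ J′ t p ≡
                         rest t p ℚ.- rest t (λRow i) ℚ.* (recip (b j) ℚ.* γ j p)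
      exponentAt′-rest t p = ≡.trans (≡.cong₂ ℚ._+_ (γ′ lastCol (lastCol≢col j) p)
          (∑∉-linear J′ (recip (b j) ℚ.* γ j p) {F} {G} λ s s∉ → ≡.trans
            (≡.cong (fromℤ (t s) ℚ.*_) (γ′ (col s) (∉∪⇒≢ {J = J} s∉ ∘ col-injective) p))
            (solve 5 (λ t g b β h → t :* (g :- b :* β :* h) := t :* g :- t :* b :* (β :* h)) ≡.refl
              (fromℤ (t s)) (γ s p) (b s) (recip (b j)) (γ j p))))
        (≡.trans (solve 6 (λ g b β h x y → g :- b :* β :* h :+ (x :- y :* (β :* h)) := g :+ x :- (b :+ y) :* (β :* h)) ≡.refl
              (γ₀ p) (O (λRow i) lastCol) (recip (b j)) (γ j p) (∑∉ J′ F) (∑∉ J′ G))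
          (≡.cong (λ z → rest t p ℚ.- z ℚ.* (recip (b j) ℚ.* γ j p)) (≡.sym (rest-pivotRow t))))
        where
        F G : Vector ℚ n
        F s = fromℤ (t s) ℚ.* γ s p
        G s = fromℤ (t s) ℚ.* b s

      rest-yRow : ∀ t → rest t (yRow j) ≡ 0ℚ
      rest-yRow t = ≡.cong₂ ℚ._+_ (≡.trans (exponents-yRow O I lastCol j) (last-zero j j∉J))
        (∑∉-zero J′ λ s s∉ → ≡.trans
          (≡.cong (fromℤ (t s) ℚ.*_) (γ-off-diagonal s j (∉∪⇒∉ {J = J} s∉) j∉J (∉∪⇒≢ {J = J} s∉)))
          (ℚ.*-zeroʳ (fromℤ (t s))))

      restᵢ-cancel : ∀ x → x ℚ.* (recip (b j) ℚ.* b j) ≡ x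
      restᵢ-cancel x = ≡.trans (≡.cong (x ℚ.*_) (≡.trans (ℚ.*-comm (recip (b j)) (b j)) (recip-inverse (b j) (proj₂ aj))))
        (ℚ.*-identityʳ x)

    exponentAt-yRow : ∀ t → exponentAt O I J t (yRow j) ≡ fromℤ (t j)
    exponentAt-yRow t = ≡.trans (exponentAt-rest t (yRow j)) (≡.trans
      (≡.cong₂ ℚ._+_ (rest-yRow t) (≡.trans (≡.cong (fromℤ (t j) ℚ.*_) (γ-diagonal j j∉J)) (ℚ.*-identityʳ (fromℤ (t j)))))
      (ℚ.+-identityˡ (fromℤ (t j))))

    -- On the hyperplane where the exponent of λ_i vanishes, the pivot does not move the point of t.
    exponentAt-pivot : ∀ t → exponentAt O I J t (λRow i) ≡ 0ℚ →
                       exponentAt O′ I′ J′ t ≗ exponentAt O I J t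
    exponentAt-pivot t zeroᵢ p = ≡.trans (exponentAt′-rest t p) (≡.trans
      (≡.cong (λ z → rest t p ℚ.- z ℚ.* (recip (b j) ℚ.* γ j p)) restᵢ≡)
      (≡.trans (≡.trans
        (solve 5 (λ x t b β g → x :- (:- (t :* b)) :* (β :* g) := x :+ t :* (β :* b) :* g) ≡.refl
          (rest t p) (fromℤ (t j)) (b j) (recip (b j)) (γ j p))
        (≡.cong (λ z → rest t p ℚ.+ z ℚ.* γ j p) (restᵢ-cancel (fromℤ (t j)))))
        (≡.sym (exponentAt-rest t p))))
      where
      restᵢ≡ : rest t (λRow i) ≡ ℚ.- (fromℤ (t j) ℚ.* b j)
      restᵢ≡ = ≡.trans (solve 2 (λ x y → x := x :+ y :- y) ≡.refl (rest t (λRow i)) (fromℤ (t j) ℚ.* b j))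
        (≡.trans (≡.cong (λ z → z ℚ.- fromℤ (t j) ℚ.* b j)
          (≡.trans (≡.cong (λ z → rest t (λRow i) ℚ.+ fromℤ (t j) ℚ.* z) (≡.sym (γ-pivotRow j)))
                   (≡.trans (≡.sym (exponentAt-rest t (λRow i))) zeroᵢ)))
          (ℚ.+-identityˡ _))

    -- After the pivot the exponent of y_j is -rest_i / b_j, where rest_i is the entry of `rest` in
    -- the row of λ_i. This is the value of t_j that makes the exponent of λ_i vanish before the
    -- pivot. The old `t j` is free to be overwritten, since column `j` no longer occurs.
    exponentAt-unpivot : ∀ t k → exponentAt O′ I′ J′ t (yRow j) ≡ fromℤ k →
                         let t′ = updateAt t j (const k) in
                         exponentAt O I J t′ (λRow i) ≡ 0ℚ × exponentAt O′ I′ J′ t ≗ exponentAt O I J t′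
    exponentAt-unpivot t k eq = zeroᵢ , same
      where
      t′ = updateAt t j (const k)
      rest-t′ : ∀ p → rest t′ p ≡ rest t p
      rest-t′ p = ≡.cong (γ₀ p ℚ.+_) (∑∉-cong J′ λ s s∉ →
        ≡.cong (λ z → fromℤ z ℚ.* γ s p) (updateAt-minimal s j t (∉∪⇒≢ {J = J} s∉)))
      k≡ : fromℤ (t′ j) ≡ ℚ.- (rest t (λRow i) ℚ.* recip (b j))
      k≡ = ≡.trans (≡.cong fromℤ (updateAt-updates j t)) (≡.trans (≡.sym eq) (≡.trans (exponentAt′-rest t (yRow j))
        (≡.trans (≡.cong₂ (λ x g → x ℚ.- rest t (λRow i) ℚ.* (recip (b j) ℚ.* g)) (rest-yRow t) (γ-diagonal j j∉J))
          (solve 2 (λ x β → con 0ℚ :- x :* (β :* con 1ℚ) := :- (x :* β)) ≡.refl (rest t (λRow i)) (recip (b j))))))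
      form : ∀ p → exponentAt O I J t′ p ≡ rest t p ℚ.- rest t (λRow i) ℚ.* (recip (b j) ℚ.* γ j p)
      form p = ≡.trans (exponentAt-rest t′ p) (≡.trans (≡.cong₂ (λ x k → x ℚ.+ k ℚ.* γ j p) (rest-t′ p) k≡)
        (solve 4 (λ x y β g → x :+ (:- (y :* β)) :* g := x :- y :* (β :* g)) ≡.refl
          (rest t p) (rest t (λRow i)) (recip (b j)) (γ j p)))
      same : exponentAt O′ I′ J′ t ≗ exponentAt O I J t′
      same p = ≡.trans (exponentAt′-rest t p) (≡.sym (form p))
      zeroᵢ : exponentAt O I J t′ (λRow i) ≡ 0ℚ
      zeroᵢ = ≡.trans (form (λRow i)) (≡.trans
        (≡.cong (λ g → rest t (λRow i) ℚ.- rest t (λRow i) ℚ.* (recip (b j) ℚ.* g)) (γ-pivotRow j))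
        (≡.trans (≡.cong (λ z → rest t (λRow i) ℚ.- z) (restᵢ-cancel (rest t (λRow i)))) (ℚ.+-inverseʳ (rest t (λRow i)))))

-- The identity of coefficients

fromℤ-mono-≤ : ∀ {a b} → a ℤ.≤ b → fromℤ a ℚ.≤ fromℤ b
fromℤ-mono-≤ a≤b = ℚ.*≤* (ℤ.*-monoʳ-≤-nonNeg ℤ.1ℤ a≤b)

∑ℚ-mono-≤ : ∀ {n} {F G : Vector ℚ n} → (∀ s → F s ℚ.≤ G s) → ∑ℚ F ℚ.≤ ∑ℚ G
∑ℚ-mono-≤ {zero}  F≤G = ℚ.≤-refl
∑ℚ-mono-≤ {suc n} F≤G = ℚ.+-mono-≤ (F≤G zero) (∑ℚ-mono-≤ (F≤G ∘ suc))

∑ℚ-neg : ∀ {n} (F : Vector ℚ n) → ∑ℚ (λ s → ℚ.- F s) ≡ ℚ.- ∑ℚ F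
∑ℚ-neg {zero}  F = ≡.refl
∑ℚ-neg {suc n} F = ≡.trans (≡.cong (ℚ._+_ (ℚ.- F zero)) (∑ℚ-neg (tail F)))
  (≡.sym (ℚ.neg-distrib-+ (F zero) (∑ℚ (tail F))))

-- The range of exponents on which `χ u` is zero.
Vanishes : Bool → ℤ → Set
Vanishes true  t = t ℤ.< +0
Vanishes false t = +0 ℤ.≤ t

vanishes? : ∀ u t → Dec (Vanishes u t)
vanishes? true  t = t ℤ.<? +0
vanishes? false t = +0 ℤ.≤? t

-- Vanishing of the product at the two infinite cuts

module Infinity {n r : ℕ} (O : Matrix n r) (I : Subset r) (J : Subset n) (red : Reduced O J)
                (i : Fin r) (i∉I : i ∉ I) where
  open Geometry O I J red i i∉I

  private
    term-b : ∀ t s → fromℤ t ℚ.* γ s (λRow i) ≡ fromℤ t ℚ.* b s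
    term-b t s = ≡.cong (fromℤ t ℚ.*_) (γ-pivotRow s)

    times-pos : ∀ {s t u} → 0ℚ ℚ.≤ b s → t ℤ.≤ u → fromℤ t ℚ.* γ s (λRow i) ℚ.≤ fromℤ u ℚ.* b s
    times-pos {s} {t} b≥0 t≤u = ≡.subst (ℚ._≤ _) (≡.sym (term-b t s))
      (ℚ.*-monoʳ-≤-nonNeg (b s) {{ℚ.nonNegative b≥0}} (fromℤ-mono-≤ t≤u))

    times-pos′ : ∀ {s t u} → 0ℚ ℚ.≤ b s → u ℤ.≤ t → fromℤ u ℚ.* b s ℚ.≤ fromℤ t ℚ.* γ s (λRow i)
    times-pos′ {s} {t} {u} b≥0 u≤t = ≡.subst (fromℤ u ℚ.* b s ℚ.≤_) (≡.sym (term-b t s))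
      (ℚ.*-monoʳ-≤-nonNeg (b s) {{ℚ.nonNegative b≥0}} (fromℤ-mono-≤ u≤t))

    times-neg : ∀ {s t u} → b s ℚ.≤ 0ℚ → u ℤ.≤ t → fromℤ t ℚ.* γ s (λRow i) ℚ.≤ fromℤ u ℚ.* b s
    times-neg {s} {t} b≤0 u≤t = ≡.subst (ℚ._≤ _) (≡.sym (term-b t s))
      (ℚ.*-monoʳ-≤-nonPos (b s) {{ℚ.nonPositive b≤0}} (fromℤ-mono-≤ u≤t))

    times-neg′ : ∀ {s t u} → b s ℚ.≤ 0ℚ → t ℤ.≤ u → fromℤ u ℚ.* b s ℚ.≤ fromℤ t ℚ.* γ s (λRow i)
    times-neg′ {s} {t} {u} b≤0 t≤u = ≡.subst (fromℤ u ℚ.* b s ℚ.≤_) (≡.sym (term-b t s))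
      (ℚ.*-monoʳ-≤-nonPos (b s) {{ℚ.nonPositive b≤0}} (fromℤ-mono-≤ t≤u))

    -1*b : ∀ s → fromℤ ℤ.-1ℤ ℚ.* b s ≡ ℚ.- b s
    -1*b s = ≡.trans (≡.sym (ℚ.neg-distribˡ-* 1ℚ (b s))) (≡.cong ℚ.-_ (ℚ.*-identityˡ (b s)))

    sign-pos : ∀ {s} → 0ℚ ℚ.< b s → isPositive (b s) ≡ true
    sign-pos {s} = dec-true (0ℚ ℚ.<? b s)

    sign-neg : ∀ {s} → b s ℚ.< 0ℚ → isPositive (b s) ≡ false
    sign-neg {s} b<0 = dec-false (0ℚ ℚ.<? b s) (ℚ.<-asym b<0)

    summand : Vector ℤ n → Vector ℚ n
    summand t s = branch (¬? (s ∈? J)) (λ _ → fromℤ (t s) ℚ.* γ s (λRow i)) 0ℚ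

    b₀ = O (λRow i) lastCol

    exponent-pivotRow : ∀ t → exponentAt O I J t (λRow i) ≡ b₀ ℚ.+ ∑ℚ (summand t)
    exponent-pivotRow t = ≡.cong (ℚ._+ ∑ℚ (summand t)) (exponents-λRow O I lastCol i i∉I)

  Vanishing : Bool → Vector ℤ n → Fin n → Set
  Vanishing u t s = Active s × Vanishes (isPositive (b s) same-as u) (t s)

  -- If no active factor vanished at the cut above all columns, then t_s would be at most -1 where
  -- b_s > 0 and at least 0 where b_s < 0. The exponent b_0 + Σ t_s b_s of λ_i would then be bounded
  -- by the degree, which is negative.
  vanishing-below-degree : ∀ t → degree O I J i ℚ.< 0ℚ → exponentAt O I J t (λRow i) ≡ 0ℚ →
                           ¬ (∀ s → ¬ Vanishing false t s)
  vanishing-below-degree t deg<0 eq alive = ℚ.<-irrefl eq (ℚ.≤-<-trans bound deg<0)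
    where
    positives : Vector ℚ n
    positives s = branch (¬? (s ∈? J) ×-dec (0ℚ ℚ.<? b s)) (λ _ → b s) 0ℚ
    pointwise : ∀ s → summand t s ℚ.≤ ℚ.- positives s
    pointwise s = branch-elim (λ z → summand t s ℚ.≤ ℚ.- z) (¬? (s ∈? J) ×-dec (0ℚ ℚ.<? b s))
      (λ { (s∉J , b>0) → branch-elim (ℚ._≤ ℚ.- b s) (¬? (s ∈? J))
             (λ _ → ≡.subst (fromℤ (t s) ℚ.* γ s (λRow i) ℚ.≤_) (-1*b s) (times-pos (ℚ.<⇒≤ b>0)
               -- The large expansion starts at x^(-1), so t < 0 gives t ≤ -1. This is how each
               -- positive `b s` comes to be subtracted in the degree.
               (ℤ.i<j⇒i≤pred[j] (ℤ.≰⇒> (λ 0≤t → alive s ((s∉J , (λ b≡0 → ℚ.<-irrefl (≡.sym b≡0) b>0)) ,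
                 ≡.subst (λ u → Vanishes (u same-as false) (t s)) (≡.sym (sign-pos b>0)) 0≤t))))))
             (contradiction s∉J) })
      (λ ¬pos → branch-elim (ℚ._≤ 0ℚ) (¬? (s ∈? J))
        (λ s∉J → nonpos s∉J (ℚ.≮⇒≥ (λ b>0 → ¬pos (s∉J , b>0))))
        (λ _ → ℚ.≤-refl))
      where
      nonpos : s ∉ J → b s ℚ.≤ 0ℚ → fromℤ (t s) ℚ.* γ s (λRow i) ℚ.≤ 0ℚ
      nonpos s∉J b≤0 with ℚ.<-cmp (b s) 0ℚ
      ... | tri> _ _ b>0 = contradiction (ℚ.<-≤-trans b>0 b≤0) (ℚ.<-irrefl ≡.refl)
      ... | tri≈ _ b≡0 _ = ℚ.≤-reflexive (≡.trans (term-b (t s) s)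
        (≡.trans (≡.cong (fromℤ (t s) ℚ.*_) b≡0) (ℚ.*-zeroʳ (fromℤ (t s)))))
      ... | tri< b<0 b≢0 _ = ≡.subst (fromℤ (t s) ℚ.* γ s (λRow i) ℚ.≤_) (ℚ.*-zeroˡ (b s)) (times-neg b≤0
        (ℤ.≮⇒≥ (λ t<0 → alive s ((s∉J , b≢0) ,
          ≡.subst (λ u → Vanishes (u same-as false) (t s)) (≡.sym (sign-neg b<0)) t<0))))
    bound : exponentAt O I J t (λRow i) ℚ.≤ degree O I J i
    bound = ≡.subst₂ ℚ._≤_ (≡.sym (exponent-pivotRow t)) (≡.cong (b₀ ℚ.+_) (∑ℚ-neg positives))
      (ℚ.+-monoʳ-≤ b₀ (∑ℚ-mono-≤ pointwise))

  -- The mirror image, at the cut below all columns: nonvanishing factors need t_s ≥ 0 where b_s > 0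
  -- and t_s ≤ -1 where b_s < 0, so the exponent of λ_i would be at least minus the order, which is
  -- positive.
  vanishing-above-order : ∀ t → order O I J i ℚ.< 0ℚ → exponentAt O I J t (λRow i) ≡ 0ℚ →
                          ¬ (∀ s → ¬ Vanishing true t s)
  vanishing-above-order t ord<0 eq alive =
    ℚ.<-irrefl (≡.sym eq) (ℚ.<-≤-trans (ℚ.neg-antimono-< ord<0) bound)
    where
    negatives : Vector ℚ n
    negatives s = branch (¬? (s ∈? J) ×-dec (b s ℚ.<? 0ℚ)) (λ _ → b s) 0ℚ
    pointwise : ∀ s → ℚ.- negatives s ℚ.≤ summand t s
    pointwise s = branch-elim (λ z → ℚ.- z ℚ.≤ summand t s) (¬? (s ∈? J) ×-dec (b s ℚ.<? 0ℚ))
      (λ { (s∉J , b<0) → branch-elim (ℚ.- b s ℚ.≤_) (¬? (s ∈? J))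
             (λ _ → ≡.subst (ℚ._≤ fromℤ (t s) ℚ.* γ s (λRow i)) (-1*b s) (times-neg′ (ℚ.<⇒≤ b<0)
               (ℤ.i<j⇒i≤pred[j] (ℤ.≰⇒> (λ 0≤t → alive s ((s∉J , (λ b≡0 → ℚ.<-irrefl b≡0 b<0)) ,
                 ≡.subst (λ u → Vanishes (u same-as true) (t s)) (≡.sym (sign-neg b<0)) 0≤t))))))
             (contradiction s∉J) })
      (λ ¬neg → branch-elim (0ℚ ℚ.≤_) (¬? (s ∈? J))
        (λ s∉J → nonneg s∉J (ℚ.≮⇒≥ (λ b<0 → ¬neg (s∉J , b<0))))
        (λ _ → ℚ.≤-refl))
      where
      nonneg : s ∉ J → 0ℚ ℚ.≤ b s → 0ℚ ℚ.≤ fromℤ (t s) ℚ.* γ s (λRow i)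
      nonneg s∉J b≥0 with ℚ.<-cmp (b s) 0ℚ
      ... | tri< b<0 _ _ = contradiction (ℚ.≤-<-trans b≥0 b<0) (ℚ.<-irrefl ≡.refl)
      ... | tri≈ _ b≡0 _ = ℚ.≤-reflexive (≡.sym (≡.trans (term-b (t s) s)
        (≡.trans (≡.cong (fromℤ (t s) ℚ.*_) b≡0) (ℚ.*-zeroʳ (fromℤ (t s))))))
      ... | tri> _ b≢0 b>0 = ≡.subst (ℚ._≤ fromℤ (t s) ℚ.* γ s (λRow i)) (ℚ.*-zeroˡ (b s)) (times-pos′ b≥0
        (ℤ.≮⇒≥ (λ t<0 → alive s ((s∉J , b≢0) ,
          ≡.subst (λ u → Vanishes (u same-as true) (t s)) (≡.sym (sign-pos b>0)) t<0))))
    bound : ℚ.- order O I J i ℚ.≤ exponentAt O I J t (λRow i)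
    bound = ≡.subst₂ ℚ._≤_ left (≡.sym (exponent-pivotRow t)) (ℚ.+-monoʳ-≤ b₀ (∑ℚ-mono-≤ pointwise))
      where
      left : b₀ ℚ.+ ∑ℚ (λ s → ℚ.- negatives s) ≡ ℚ.- order O I J i
      left = ≡.trans (≡.cong (b₀ ℚ.+_) (∑ℚ-neg negatives))
        (solve 2 (λ b e → b :+ :- e := :- (:- b :+ e)) ≡.refl b₀ (∑ℚ negatives))
        where open +-*-Solver

-- Comparison of the constant term with the pivoted terms

module Assembly {c ℓ} (K : CommutativeRing c ℓ) {n r : ℕ}
    (O : Matrix n r) (I : Subset r) (J : Subset n) (red : Reduced O J) (i : Fin r) (i∉I : i ∉ I)
    (N : ℕ) .{{N≢0 : ℕ.NonZero N}} (d∣N : DenominatorsDivide N O)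
    (red′ : ∀ j → j ∉ J → (b≢0 : O (λRow i) (col j) ≢ 0ℚ) →
            Reduced (pivot O i j {{≢-nonZero b≢0}}) (J ∪ ⁅ j ⁆))
    (d∣N′ : ∀ j → j ∉ J → (b≢0 : O (λRow i) (col j) ≢ 0ℚ) →
            DenominatorsDivide N (pivot O i j {{≢-nonZero b≢0}})) where

  open CommutativeRing K hiding (zero)
  open Telescoping commutativeSemiring
  open Expansions K N
  open Brackets rawRing N {n} {r} using (bracket; pivotTerm; contributingSum; duallyContributingSum)
  open Series rawRing N
  open Geometry O I J red i i∉I
  open Infinity O I J red i i∉I using (Vanishing; vanishing-below-degree; vanishing-above-order)
  open import Algebra.Properties.Ring ring using (-0#≈0#; +-inverseʳ-unique)
  open import Algebra.Properties.Semiring.Sum semiring using (sum; sum-cong-≋)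
  open import Algebra.Properties.Monoid.Sum *-monoid using () renaming (sum-cong-≗ to ∏-cong-≗)
  open import Relation.Binary.Reasoning.Setoid setoid hiding (start)

  private
    dim = n ℕ.+ r

  coef-sgn-* : ∀ q f e → coef dim (𝔾._*_ dim (sgn dim q) f) e ≈ sgn 0 q * coef dim f e
  coef-sgn-* q f e = trans
    (coef-* dim (sgn dim q) f e e λ x x≇e → trans
      (*-congʳ (elsewhere q (e ⊖ x) λ e-x≗0 → x≇e λ p → ≡.sym (ℤ.i-j≡0⇒i≡j (e p) (x p) (e-x≗0 p)))) (zeroˡ _))
    (*-congʳ (origin q (e ⊖ e) λ p → ℤ.i≡j⇒i-j≡0 {e p} {e p} ≡.refl))
    where
    one : ∀ e → e ≗ (λ _ → +0) → coef dim (𝔾.1# dim) e ≈ 1#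
    one e e≗0 = trans (coef-≡ dim (monomial-0 dim) e) (coef-monomial dim (λ _ → +0) e e≗0)
    one-≢ : ∀ e → ¬ e ≗ (λ _ → +0) → coef dim (𝔾.1# dim) e ≈ 0#
    one-≢ e e≇0 = trans (coef-≡ dim (monomial-0 dim) e) (coef-monomial-≢ dim (λ _ → +0) e e≇0)
    origin : ∀ q e → e ≗ (λ _ → +0) → coef dim (sgn dim q) e ≈ sgn 0 q
    origin q e e≗0 with ℚ.<-cmp q 0ℚ
    ... | tri< _ _ _ = trans (coef-neg dim (𝔾.1# dim) e) (-‿cong (one e e≗0))
    ... | tri≈ _ _ _ = coef-0# dim e
    ... | tri> _ _ _ = one e e≗0
    elsewhere : ∀ q e → ¬ e ≗ (λ _ → +0) → coef dim (sgn dim q) e ≈ 0#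
    elsewhere q e e≇0 with ℚ.<-cmp q 0ℚ
    ... | tri< _ _ _ = trans (coef-neg dim (𝔾.1# dim) e) (trans (-‿cong (one-≢ e e≇0)) -0#≈0#)
    ... | tri≈ _ _ _ = coef-0# dim e
    ... | tri> _ _ _ = one-≢ e e≇0

  module _ (t : Vector ℤ n) where

    -- The factor of column s when the cut lies below (u = true) or above (u = false) that column.
    factor : Fin n → Bool → Carrier
    factor s u = if does (s ∈? J) then 1# else
      (if does (b s ℚ.≟ 0ℚ) then χ (isSmall (γ s)) (t s) else χ (isPositive (b s) same-as u) (t s))

    factor-active : ∀ {s} → Active s → ∀ u → factor s u ≡ χ (isPositive (b s) same-as u) (t s)
    factor-active {s} (s∉J , b≢0) u rewrite dec-false (s ∈? J) s∉J | dec-false (b s ℚ.≟ 0ℚ) b≢0 = ≡.refl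

    factor-parallel : ∀ {s} → s ∉ J → b s ≡ 0ℚ → ∀ u → factor s u ≡ χ (isSmall (γ s)) (t s)
    factor-parallel {s} s∉J b≡0 u rewrite dec-false (s ∈? J) s∉J | dec-true (b s ℚ.≟ 0ℚ) b≡0 = ≡.refl

    factor-used : ∀ {s} → ¬ s ∉ J → ∀ u → factor s u ≡ 1#
    factor-used {s} s∈J u with s ∈? J
    ... | yes _  = ≡.refl
    ... | no s∉J = contradiction s∉J s∈J

    factor-inactive : ∀ s → active s ≡ false → factor s false ≈ factor s true
    factor-inactive s eq with s ∈? J | b s ℚ.≟ 0ℚ
    ... | yes _ | _     = refl
    ... | no _  | yes _ = refl
    ... | no _  | no _ with () ← eq

    -- The difference of `χ true` and `χ false` is 1 at every integer; a negative `b s` exchanges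
    -- the two and reverses the sign.
    factor-step : ∀ s → active s ≡ true → sgn 0 (b s) + factor s false ≈ factor s true
    factor-step s eq = trans (+-congˡ (reflexive (factor-active as false)))
      (trans (jump-χ (t s)) (reflexive (≡.sym (factor-active as true))))
      where
      as = active⇒Active eq
      jump-χ : ∀ t → sgn 0 (b s) + χ (isPositive (b s) same-as false) t ≈ χ (isPositive (b s) same-as true) t
      jump-χ t with ℚ.<-cmp (b s) 0ℚ
      ... | tri≈ _ b≡0 _ = contradiction b≡0 (proj₂ as)
      ... | tri< b<0 _ _ rewrite dec-false (0ℚ ℚ.<? b s) (ℚ.<-asym b<0) = below t
        where
        below : ∀ t → - 1# + χ true t ≈ χ false t
        below (+ _)    = -‿inverseˡ 1#
        below -[1+ _ ] = +-identityʳ (- 1#)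
      ... | tri> _ _ b>0 rewrite dec-true (0ℚ ℚ.<? b s) b>0 = over t
        where
        over : ∀ t → 1# + χ false t ≈ χ true t
        over (+ _)    = +-identityʳ 1#
        over -[1+ _ ] = -‿inverseʳ 1#

    weight-∏ : weight N K O I J red d∣N t ≡ ∏ (λ s → factor s (aboveZero s))
    weight-∏ = ∏-cong-≗ pointwise
      where
      pointwise : ∀ s → branch (¬? (s ∈? J)) (λ _ → χ (isSmall (γ s)) (t s)) 1# ≡ factor s (aboveZero s)
      pointwise s = branch-elim (_≡ factor s (aboveZero s)) (¬? (s ∈? J))
        (λ s∉J → unused s∉J (b s ℚ.≟ 0ℚ)) (λ s∈J → ≡.sym (factor-used s∈J (aboveZero s)))
        where
        unused : s ∉ J → Dec (b s ≡ 0ℚ) → χ (isSmall (γ s)) (t s) ≡ factor s (aboveZero s)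
        unused s∉J (yes b≡0) = ≡.sym (factor-parallel s∉J b≡0 (aboveZero s))
        unused s∉J (no b≢0)  = ≡.trans (≡.cong (λ u → χ u (t s)) (isSmall-γ (s∉J , b≢0)))
          (≡.sym (factor-active (s∉J , b≢0) (aboveZero s)))

    -- By `isSmall-γ′` the smallness of a pivoted active column records its side of the cut through
    -- `j`, while columns with `b s` zero are not moved by the pivot. The omitted factor matches the
    -- enlargement of `J` by `j`.
    weight-omit : ∀ {j} ((j∉J , b≢0) : Active j) →
                  weight N K (pivot O i j {{≢-nonZero b≢0}}) (I ∪ ⁅ i ⁆) (J ∪ ⁅ j ⁆) (red′ j j∉J b≢0) (d∣N′ j j∉J b≢0) t ≡
                  omit (λ s → factor s (above j s)) j
    weight-omit {j} aj@(j∉J , bj≢0) = ∏-cong-≗ pointwise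
      where
      open AfterPivot aj
      pointwise : ∀ s → branch (¬? (s ∈? J′)) (λ _ → χ (isSmall (exponents O′ I′ (col s))) (t s)) 1# ≡
                  (if does (s Fin.≟ j) then 1# else factor s (above j s))
      pointwise s with s Fin.≟ j
      ... | yes ≡.refl = branch-elim (_≡ 1#) (¬? (s ∈? J′))
        (λ s∉J′ → contradiction ≡.refl (∉∪⇒≢ {J = J} s∉J′)) (λ _ → ≡.refl)
      ... | no s≢j = branch-elim (_≡ factor s (above j s)) (¬? (s ∈? J′))
        (λ s∉J′ → unused (∉∪⇒∉ {J = J} s∉J′) (b s ℚ.≟ 0ℚ))
        (λ s∈J′ → ≡.sym (factor-used (λ s∉J → s∈J′ (∉∪ s∉J s≢j)) (above j s)))
        where
        unused : s ∉ J → Dec (b s ≡ 0ℚ) → χ (isSmall (exponents O′ I′ (col s))) (t s) ≡ factor s (above j s)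
        unused s∉J (yes b≡0) = ≡.trans (≡.cong (λ u → χ u (t s)) (isSmall-γ′-inactive b≡0 s≢j))
          (≡.sym (factor-parallel s∉J b≡0 (above j s)))
        unused s∉J (no b≢0)  = ≡.trans (≡.cong (λ u → χ u (t s)) (isSmall-γ′ (s∉J , b≢0) s≢j))
          (≡.sym (factor-active (s∉J , b≢0) (above j s)))

    ∏-vanishing : ∀ u → ¬ (∀ s → ¬ Vanishing u t s) → ∏ (λ s → factor s u) ≈ 0#
    -- A search through the finitely many columns turns the doubly negated existence into a witness.
    ∏-vanishing u ¬alive with Fin.any? (λ s → active? s ×-dec vanishes? (isPositive (b s) same-as u) (t s))
    ... | no nowhere = contradiction (λ s v → nowhere (s , v)) ¬alive
    ... | yes (s , as , vs) = ∏-zero (λ s → factor s u) s (trans (reflexive (factor-active as u)) (χ-zero _ (t s) vs))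
      where
      χ-zero : ∀ u t → Vanishes u t → χ u t ≈ 0#
      χ-zero true  -[1+ _ ] _ = refl
      χ-zero false (+ _)    _ = refl
      χ-zero true  (+ _) (ℤ.+<+ ())
      ∏-zero : ∀ {n} (F : Fin n → Carrier) s → F s ≈ 0# → ∏ F ≈ 0#
      ∏-zero F zero    F≈0 = trans (*-congʳ F≈0) (zeroˡ _)
      ∏-zero F (suc s) F≈0 = trans (*-congˡ (∏-zero (F ∘ suc) s F≈0)) (zeroʳ _)

  private
    fromℤN≢0 : fromℤ (+ N) ≢ 0ℚ
    fromℤN≢0 eq = ℕ.≢-nonZero⁻¹ N (ℤ.+-injective (fromℤ-injective {+ N} {+0} eq))

    At-zero : ∀ {e : Vector ℤ dim} α → _At_ N e α → ∀ p → α p ≡ 0ℚ → e p ≡ +0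
    At-zero α eAt p αp≡0 = fromℤ-injective (≡.trans (eAt p) (≡.trans (≡.cong (fromℤ (+ N) ℚ.*_) αp≡0) (ℚ.*-zeroʳ (fromℤ (+ N)))))

    zero-At : ∀ {e : Vector ℤ dim} α → _At_ N e α → ∀ p → e p ≡ +0 → α p ≡ 0ℚ
    zero-At α eAt p ep≡0 = *-cancel-ℚ (fromℤ (+ N)) fromℤN≢0
      (≡.trans (≡.sym (eAt p)) (≡.trans (≡.cong fromℤ ep≡0) (≡.sym (ℚ.*-zeroʳ (fromℤ (+ N))))))

    At-multiple : ∀ {e : Vector ℤ dim} α → _At_ N e α → ∀ p k → α p ≡ fromℤ k → e p ≡ k ℤ.* + N
    At-multiple α eAt p k αp≡k = fromℤ-injective (≡.trans (eAt p) (≡.trans (≡.cong (fromℤ (+ N) ℚ.*_) αp≡k)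
      (≡.trans (ℚ.*-comm (fromℤ (+ N)) (fromℤ k)) (≡.sym (fromℤ-* k (+ N))))))

    multiple-At : ∀ {e : Vector ℤ dim} α → _At_ N e α → ∀ p k → e p ≡ k ℤ.* + N → α p ≡ fromℤ k
    multiple-At α eAt p k ep≡ = *-cancel-ℚ (fromℤ (+ N)) fromℤN≢0
      (≡.trans (≡.sym (eAt p)) (≡.trans (≡.cong fromℤ ep≡) (≡.trans (fromℤ-* k (+ N)) (ℚ.*-comm (fromℤ k) (fromℤ (+ N))))))

  -- Both sides are supported on these exponents: the constant term through `CT`, the pivoted terms
  -- through `exponentAt-unpivot`.
  OnSlice : Vector ℤ dim → Vector ℤ n → Set
  OnSlice e t = _At_ N e (exponentAt O I J t) × exponentAt O I J t (λRow i) ≡ 0ℚ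

  onSlice? : ∀ e → Dec (∃[ t ] OnSlice e t)
  onSlice? e with bracket-At? N K O I J red d∣N e | e (λRow i) ℤ.≟ +0
  ... | no nowhere      | _         = no λ { (t , eAt , _) → nowhere (t , eAt) }
  ... | yes (t , eAt)   | yes eᵢ≡0  = yes (t , eAt , zero-At (exponentAt O I J t) eAt (λRow i) eᵢ≡0)
  ... | yes _           | no eᵢ≢0   = no λ { (t , eAt , zeroᵢ) → eᵢ≢0 (At-zero (exponentAt O I J t) eAt (λRow i) zeroᵢ) }

  coef-CT-slice : ∀ e t → OnSlice e t →
                  coef dim (CT (λRow {n = n} i) (bracket O I J)) e ≈ ∏ (λ s → factor t s (aboveZero s))
  coef-CT-slice e t (eAt , zeroᵢ) = trans
    (coef-CT dim (λRow {n = n} i) (bracket O I J) e (At-zero (exponentAt O I J t) eAt (λRow i) zeroᵢ))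
    (trans (coef-bracket N K O I J red d∣N t e eAt) (reflexive (weight-∏ t)))

  coef-CT-off-slice : ∀ e → (∀ t → ¬ OnSlice e t) → coef dim (CT (λRow {n = n} i) (bracket O I J)) e ≈ 0#
  coef-CT-off-slice e nowhere with e (λRow i) ℤ.≟ +0
  ... | no eᵢ≢0  = coef-CT-≢ dim (λRow {n = n} i) (bracket O I J) e eᵢ≢0
  ... | yes eᵢ≡0 = trans (coef-CT dim (λRow {n = n} i) (bracket O I J) e eᵢ≡0)
    (coef-bracket-0 N K O I J red d∣N e (λ t eAt → nowhere t (eAt , zero-At (exponentAt O I J t) eAt (λRow i) eᵢ≡0)))

  coef-pivotTerm : ∀ e t → OnSlice e t → ∀ {j} ((j∉J , b≢0) : Active j) →
                   coef dim (pivotTerm O I J i j b≢0) e ≈ sgn 0 (b j) * omit (λ s → factor t s (above j s)) j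
  coef-pivotTerm e t (eAt , zeroᵢ) {j} aj@(j∉J , b≢0) = trans (coef-sgn-* (b j) _ e) (*-congˡ
    (trans (coef-𝒵 dim (yRow j) _ e (ℤ.divides (t j)
             (At-multiple (exponentAt O I J t) eAt (yRow j) (t j) (exponentAt-yRow t))))
    (trans (coef-bracket N K O′ I′ J′ (red′ j j∉J b≢0) (d∣N′ j j∉J b≢0) t e
             (λ p → ≡.trans (eAt p) (≡.cong (fromℤ (+ N) ℚ.*_) (≡.sym (exponentAt-pivot t zeroᵢ p)))))
    (reflexive (weight-omit t aj)))))
    where open AfterPivot aj

  -- Here 𝒵 is essential: a pivoted bracket may have terms with fractional exponent of y_j, and
  -- those correspond to no term of the original one. If the exponent is an integer,
  -- `exponentAt-unpivot` produces an index on the slice.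
  coef-pivotTerm-0 : ∀ e → (∀ t → ¬ OnSlice e t) → ∀ {j} ((j∉J , b≢0) : Active j) →
                     coef dim (pivotTerm O I J i j b≢0) e ≈ 0#
  coef-pivotTerm-0 e nowhere {j} aj@(j∉J , b≢0) = trans (coef-sgn-* (b j) _ e) (trans (*-congˡ outside) (zeroʳ _))
    where
    open AfterPivot aj
    outside : coef dim (𝒵 (yRow j) (bracket O′ I′ J′)) e ≈ 0#
    outside with + N ℤ.∣? e (yRow j)
    ... | no N∤e = coef-𝒵-∤ dim (yRow j) _ e N∤e
    ... | yes N∣e@(ℤ.divides k ep≡) = trans (coef-𝒵 dim (yRow j) _ e N∣e)
      (coef-bracket-0 N K O′ I′ J′ (red′ j j∉J b≢0) (d∣N′ j j∉J b≢0) e λ t eAt →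
        let zeroᵢ , same = exponentAt-unpivot t k (multiple-At (exponentAt O′ I′ J′ t) eAt (yRow j) k ep≡)
        in nowhere (updateAt t j (const k)) ((λ p → ≡.trans (eAt p) (≡.cong (fromℤ (+ N) ℚ.*_) (same p))) , zeroᵢ))

  module _ {p} {C : Pred (Fin n) p} (C? : Decidable C) (C⇒Active : ∀ {j} → C j → Active j) where

    -- Stated for any decidable family of active columns, so that the contributing and the dually
    -- contributing sum are both instances by computation.
    pivotSum : ∣G dim ∣
    pivotSum = foldOver (𝔾.+-rawMonoid dim) C? (λ j Cj → pivotTerm O I J i j (proj₂ (C⇒Active Cj)))

    private
      summands : Fin n → ∣G dim ∣
      summands j = branch (C? j) (λ Cj → pivotTerm O I J i j (proj₂ (C⇒Active Cj))) (𝔾.0# dim)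

    coef-pivotSum : ∀ e t → OnSlice e t → ∀ lower upper →
                    (∀ j → between active above (factor t) (λ s → sgn 0 (b s)) lower upper j ≡ does (C? j)) →
                    coef dim pivotSum e ≈ sum (jump active above (factor t) (λ s → sgn 0 (b s)) lower upper)
    coef-pivotSum e t on lower upper agree = trans (coef-sum dim summands e) (sum-cong-≋ summand)
      where
      σ = λ s → sgn 0 (b s)
      summand : ∀ j → coef dim (summands j) e ≈
                jump active above (factor t) σ lower upper j
      summand j with C? j | agree j
      ... | yes Cj | inside rewrite inside = coef-pivotTerm e t on (C⇒Active Cj)
      ... | no _   | outside rewrite outside = coef-0# dim e

    coef-pivotSum-0 : ∀ e → (∀ t → ¬ OnSlice e t) → coef dim pivotSum e ≈ 0#
    coef-pivotSum-0 e nowhere = trans (coef-sum dim summands e) (sum-zero _ λ j →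
      branch-elim (λ f → coef dim f e ≈ 0#) (C? j) (λ Cj → coef-pivotTerm-0 e nowhere (C⇒Active Cj)) (λ _ → coef-0# dim e))

  private
    cut-identity : ∀ t lower upper → UpClosed active above lower → UpClosed active above upper →
                   (∀ j → active j ≡ true → upper j ≡ true → lower j ≡ true) →
                   sum (jump active above (factor t) (λ s → sgn 0 (b s)) lower upper) + ∏ (λ s → factor t s (upper s)) ≈
                   ∏ (λ s → factor t s (lower s))
    cut-identity t lower upper = telescope active above (factor t) (λ s → sgn 0 (b s)) lower upper line
      (factor-step t) (factor-inactive t)

  CT-contributing : degree O I J i ℚ.< 0ℚ →
                    𝔾._≈_ dim (CT (λRow {n = n} i) (bracket O I J)) (contributingSum O I J i)
  CT-contributing deg<0 = coef-ext dim λ e → compare e (onSlice? e)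
    where
    C⇒Active : ∀ {j} → Contributing O I J i j → Active j
    C⇒Active con = proj₁ con , proj₁ (proj₂ con)
    agree : ∀ j → Dec (Active j) → active j ∧ (aboveZero j ∧ true) ≡ does (contributing? O I J i j)
    agree j (no ¬a) rewrite dec-false (active? j) ¬a = ≡.sym (dec-false (contributing? O I J i j) (¬a ∘ C⇒Active))
    agree j (yes a) rewrite Active⇒active a | dec-false (j ∈? J) (proj₁ a) | dec-false (b j ℚ.≟ 0ℚ) (proj₂ a) =
      ≡.trans (∧-identityʳ (aboveZero j)) (≡.sym (isSmall-bγ a))
    compare : ∀ e → Dec (∃[ t ] OnSlice e t) →
              coef dim (CT (λRow {n = n} i) (bracket O I J)) e ≈ coef dim (contributingSum O I J i) e
    compare e (no nowhere) = trans (coef-CT-off-slice e (λ t on → nowhere (t , on)))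
      (sym (coef-pivotSum-0 (contributing? O I J i) C⇒Active e (λ t on → nowhere (t , on))))
    compare e (yes (t , on)) = begin
      coef dim (CT (λRow {n = n} i) (bracket O I J)) e  ≈⟨ coef-CT-slice e t on ⟩
      ∏ (λ s → factor t s (aboveZero s))
        -- The range from zero to plus infinity: `const false` is the cut with no column above it.
        ≈⟨ cut-identity t aboveZero (const false) aboveZero-up (λ _ _ _ _ _ ()) (λ _ _ ()) ⟨
      total + ∏ (λ s → factor t s false)
        ≈⟨ +-congˡ (∏-vanishing t false (vanishing-below-degree t deg<0 (proj₂ on))) ⟩
      total + 0#                                      ≈⟨ +-identityʳ total ⟩
      total
        ≈⟨ coef-pivotSum (contributing? O I J i) C⇒Active e t on aboveZero (const false)
             (λ j → agree j (active? j)) ⟨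
      coef dim (contributingSum O I J i) e ∎
      where total = sum (jump active above (factor t) (λ s → sgn 0 (b s)) aboveZero (const false))

  CT-duallyContributing : order O I J i ℚ.< 0ℚ →
    𝔾._≈_ dim (CT (λRow {n = n} i) (bracket O I J)) (𝔾.-_ dim (duallyContributingSum O I J i))
  CT-duallyContributing ord<0 = coef-ext dim λ e → trans (compare e (onSlice? e))
    (sym (coef-neg dim (duallyContributingSum O I J i) e))
    where
    C⇒Active : ∀ {j} → DuallyContributing O I J i j → Active j
    C⇒Active con = proj₁ con , proj₁ (proj₂ con)
    agree : ∀ j → Dec (Active j) → active j ∧ not (aboveZero j) ≡ does (duallyContributing? O I J i j)
    agree j (no ¬a) rewrite dec-false (active? j) ¬a = ≡.sym (dec-false (duallyContributing? O I J i j) (¬a ∘ C⇒Active))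
    agree j (yes a) rewrite Active⇒active a | dec-false (j ∈? J) (proj₁ a) | dec-false (b j ℚ.≟ 0ℚ) (proj₂ a) =
      ≡.trans (≡.cong not (≡.sym (isSmall-bγ a))) (≡.sym (isLarge (λ p → b j ℚ.* γ j p) (yRow j)
        (λ eq → proj₂ a (≡.trans (≡.sym (≡.trans (≡.cong (b j ℚ.*_) (γ-diagonal j (proj₁ a))) (ℚ.*-identityʳ (b j)))) eq))))
      where
      isLarge : ∀ (α : Vector ℚ dim) q → α q ≢ 0ℚ → does (large? α) ≡ not (isSmall α)
      isLarge α q αq≢0 with small-or-large α q αq≢0
      ... | inj₁ s = ≡.trans (dec-false (large? α) (small⇒¬large s)) (≡.cong not (≡.sym (small⇒isSmall α s)))
      ... | inj₂ l = ≡.trans (dec-true (large? α) l) (≡.cong not (≡.sym (large⇒¬isSmall α l)))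
    compare : ∀ e → Dec (∃[ t ] OnSlice e t) →
              coef dim (CT (λRow {n = n} i) (bracket O I J)) e ≈ - coef dim (duallyContributingSum O I J i) e
    compare e (no nowhere) = trans (coef-CT-off-slice e (λ t on → nowhere (t , on)))
      (sym (trans (-‿cong (coef-pivotSum-0 (duallyContributing? O I J i) C⇒Active e (λ t on → nowhere (t , on)))) -0#≈0#))
    compare e (yes (t , on)) = begin
      coef dim (CT (λRow {n = n} i) (bracket O I J)) e  ≈⟨ coef-CT-slice e t on ⟩
      ∏ (λ s → factor t s (aboveZero s))              ≈⟨ +-inverseʳ-unique total _ (trans
        -- The range from minus infinity to zero. The constant term now stands at the upper end,
        -- next to the sum, and the lower end vanishes; hence the minus sign.
        (cut-identity t (const true) aboveZero (λ _ _ _ _ _ _ → ≡.refl) aboveZero-up (λ _ _ _ → ≡.refl))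
        (∏-vanishing t true (vanishing-above-order t ord<0 (proj₂ on)))) ⟩
      - total
        ≈⟨ -‿cong (coef-pivotSum (duallyContributing? O I J i) C⇒Active e t on (const true) aboveZero
             (λ j → agree j (active? j))) ⟨
      - coef dim (duallyContributingSum O I J i) e ∎
      where total = sum (jump active above (factor t) (λ s → sgn 0 (b s)) (const true) aboveZero)

lemma17 : ∀ {c ℓ} (K : CommutativeRing c ℓ) {n r : ℕ}
    (A : Fin r → Fin n → ℤ) (b : Fin r → ℤ)
    (k : ℕ) (I : Subset r) (J : Subset n) (O : Matrix n r) →
    Pivots (initial A b) k I J O →
    (i : Fin r) → i ∉ I →
    (N : ℕ) → .{{_ : ℕ.NonZero N}} →
    DenominatorsDivide N O →
    (∀ j → j ∉ J → .{{_ : NonZero (O (λRow i) (col j))}} → DenominatorsDivide N (pivot O i j)) →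
    let open Brackets (CommutativeRing.rawRing K) N {n} {r} in
    (𝔠⁺ O I J i <⁺ ⊤⁺ →
    CT (λRow {n = n} i) (bracket O I J) ≈ contributingSum O I J i)
    ×
    (𝔠⁻ O I J i <⁺ ⊤⁺ →
    CT (λRow {n = n} i) (bracket O I J) ≈ - duallyContributingSum O I J i)
lemma17 K A b k I J O pivots i i∉I N d∣N d∣N′ =
  -- Nothing proves `⊤⁺ <⁺ ⊤⁺`, so finiteness of the count leaves only the branch in which the
  -- degree is negative.
  (λ finite → CT-contributing (branch-elim (λ z → z <⁺ ⊤⁺ → degree O I J i ℚ.< 0ℚ) (degree O I J i ℚ.<? 0ℚ)
    (λ deg<0 _ → deg<0) (λ _ ()) finite)) ,
  (λ finite → CT-duallyContributing (branch-elim (λ z → z <⁺ ⊤⁺ → order O I J i ℚ.< 0ℚ) (order O I J i ℚ.<? 0ℚ)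
    (λ ord<0 _ → ord<0) (λ _ ()) finite))
  where
  open Assembly K O I J (reduced pivots) i i∉I N d∣N
    (λ j j∉J b≢0 → reduced (step pivots i j i∉I j∉J {{≢-nonZero b≢0}}))
    (λ j j∉J b≢0 → d∣N′ j j∉J {{≢-nonZero b≢0}})
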